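{- Let $\Sigma$ be a ranked alphabet. A $\Sigma$-labelled tree is generated by an incrementally-bound order-$n$ recursion scheme if and only if it is accepted by an order-$n$ pushdown automaton.
   Context: **Types and recursion schemes.** Simple types are built from one atom $o$ by $\to$; every type has the form $A_1\to\dots\to A_m\to o$, and $m$ is its arity. $\mathrm{ord}(o)=0$ and $\mathrm{ord}(A\to B)=\max(\mathrm{ord}(A)+1,\mathrm{ord}(B))$. A ranked alphabet $\Sigma$ is a set of symbols, each with a type $o\to\dots\to o\to o$. A $\Sigma$-labelled tree is a possibly infinite ordered tree in which each node is labelled by some $f\in\Sigma$ and has exactly $\mathrm{arity}(f)$ children. Applicative terms over a set of typed symbols are the closure of that set under well-typed application. A recursion scheme is a tuple $\langle\Sigma,\mathcal N,\mathcal R,S\rangle$, where $\Sigma$ is a ranked alphabet of terminals, $\mathcal N$ is a finite set of typed nonterminals, $S\in\mathcal N$ has type $o$, and $\mathcal R$ contains, for each nonterminal $F:A_1\to\dots\to A_m\to o$, exactly one rule $F z_1\dots z_m\to e$. Here the $z_i:A_i$ are variables (parameters) and $e$ is an applicative term of type $o$ over $\Sigma\cup\mathcal N\cup\{z_1,\dots,z_m\}$. The scheme is order-$n$ if the highest order of a nonterminal is $n$. The tree it generates is the (possibly infinite) tree obtained as the limit (least upper bound) of unfolding the rules from $S$ forever, replacing formal by actual parameters; parts never produced are undefined ($\bot$). **Computation tree.** For a rule $F z_1\dots z_m\to e$ let $\Lambda(F)=\lambda z_1\dots z_m.e$, a simply-typed term in which terminals and nonterminals are free symbols. Terms are put in $\eta$-long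 normal form: $\lambda\overline x.\,s_0s_1\dots s_m$ with $s_0\dots s_m$ of ground type, each $s_j$ ($j\ge1$) in $\eta$-long normal form, and $s_0$ either a symbol/variable or (with $m\ge1$) an $\eta$-long abstraction. For ground type the prefix is a dummy lambda "$\lambda.$". The computation tree is $\tau(\lambda\overline x.z s_1\dots s_m)=\lambda\overline x\langle z\langle\tau(s_1),\dots,\tau(s_m)\rangle\rangle$ for a variable/symbol $z$, and $\tau(\lambda\overline x.(\lambda\overline y.t)s_1\dots s_m)=\lambda\overline x\langle @\langle\tau(\lambda\overline y.t),\tau(s_1),\dots,\tau(s_m)\rangle\rangle$ with $m\ge1$. Here $l\langle t_1,\dots,t_k\rangle$ is the tree with root label $l$ and ordered subtrees $t_i$, and $\lambda\overline x$ is a single node. Unfolding a term replaces each nonterminal $F$ in it by $\Lambda(F)$. The computation tree of the scheme is the possibly infinite tree obtained by recursively unfolding $\tau(\Lambda(S))$. **Incremental binding.** The order of a variable node is the order of its type. The order of a lambda node $\lambda x_1\dots x_k$ with $k>0$ is $1+\max_i\mathrm{ord}(x_i)$; a dummy lambda has order $0$. A computation tree is incrementally-bound if every (bound) variable node $x$ is bound by the first lambda node, on the path from it to the root, whose order is strictly greater than $\mathrm{ord}(x)$. Terminals and nonterminals are treated as constants. A recursion scheme is incrementally-bound if every finite unfolding of its computation tree is (equivalently, every finite tree obtained by pruning branches of its computation tree). **Pushdown automata.** Fix a finite alphabet $\Gamma$. An order-1 stack is a finite sequence over $\Gamma$; an order-$(k+1)$ stack is a non-empty finite sequence of order-$k$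 stacks; the last element is the top. $\bot_1$ is the empty sequence and $\bot_{k+1}=[\bot_k]$. On an order-$n$ stack ($n\ge1$): $push_1^a$ appends $a$ to the top order-1 stack; $push_j$ ($2\le j\le n$) duplicates the top order-$(j-1)$ stack; $pop_j$ ($1\le j\le n$) removes the top order-$(j-1)$ stack (an order-0 stack is a symbol); $top_1$ is the top symbol (an empty top order-1 stack is read as a distinguished bottom symbol of $\Gamma$). A tree-generating order-$n$ pushdown automaton is a tuple $\langle\Sigma,\Gamma,Q,\delta,q_0\rangle$ with $Q$ a finite set of states, $q_0\in Q$ initial, and $\delta:Q\times\Gamma\to (Q\times Op)+Out$. Here $Op$ is the set of these stack operations and $Out=\{(f,q_1,\dots,q_{\mathrm{arity}(f)}): f\in\Sigma,\ q_i\in Q\}$. From state $q$ and stack $s$: if $\delta(q,top_1 s)=(q',\phi)$, it moves to state $q'$ and stack $\phi(s)$; if $\delta(q,top_1 s)=(f,q_1,\dots,q_k)$, it outputs a node $f$ whose $i$-th subtree is generated from state $q_i$ and stack $s$. The tree accepted by the automaton is the tree so generated from $q_0$ and $\bot_n$. -}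

module Defs where

open import Data.Fin using (Fin; toℕ; fromℕ<)
open import Data.List using (List; []; _∷_; _∷ʳ_; foldr; map)
open import Data.List.Membership.Propositional using (_∈_)
open import Data.List.NonEmpty as List⁺ using (List⁺; _∷_)
open import Data.List.Relation.Unary.All as All using (All; []; _∷_)
open import Data.List.Relation.Unary.Any using (Any; here; there)
open import Data.Maybe as Maybe using (Maybe; just; nothing)
open import Data.Nat using (ℕ; zero; suc; _⊔_; _≤_; _<_; _<?_)
open import Data.Product using (∃; ∃-syntax; _×_; _,_)
open import Data.Sum using (_⊎_; inj₁; inj₂)
open import Data.Unit using (⊤)
open import Data.Vec as Vec using (Vec; []; _∷_)
open import Function using (_∘_; _⇔_)
open import Relation.Binary.Construct.Closure.ReflexiveTransitive using (Star)
open import Relation.Binary.PropositionalEquality using (_≡_; refl; subst)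
open import Relation.Nullary using (¬_; yes; no)

infixr 20 _⇒_

data Ty : Set where
  o   : Ty
  _⇒_ : Ty → Ty → Ty

args : Ty → List Ty
args o       = []
args (A ⇒ B) = A ∷ args B

ord : Ty → ℕ
ord o       = 0
ord (A ⇒ B) = suc (ord A) ⊔ ord B

record RankedAlphabet : Set₁ where
  field
    Symbol : Set
    arity  : Symbol → ℕ

groundTy : ℕ → Ty
groundTy zero    = o
groundTy (suc k) = o ⇒ groundTy k

module _ (Sg : RankedAlphabet) where
  open RankedAlphabet Sg

  -- A position is the sequence of child numbers (from 0) leading to it from
  -- the root; `nothing` means that there is no node, or no defined node, there.
  PartialTree : Set
  PartialTree = List ℕ → Maybe Symbol

  record Tree : Set where
    field
      label    : PartialTree
      root     : ∃[ f ] label [] ≡ just f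
      children : ∀ p i →
                 (∃[ g ] label (p ∷ʳ i) ≡ just g)
                   ⇔ (∃[ f ] (label p ≡ just f × i < arity f))

  infixl 25 _·_

  data Term {N : ℕ} (nty : Fin N → Ty) (Γ : List Ty) : Ty → Set where
    var : ∀ {A} → A ∈ Γ → Term nty Γ A
    ter : ∀ f → Term nty Γ (groundTy (arity f))
    non : ∀ F → Term nty Γ (nty F)
    _·_ : ∀ {A B} → Term nty Γ (A ⇒ B) → Term nty Γ A → Term nty Γ B

  record Scheme : Set where
    field
      size     : ℕ
      nty      : Fin size → Ty
      rule     : ∀ F → Term nty (args (nty F)) o
      start    : Fin size
      start-ty : nty start ≡ o

module _ {Sg : RankedAlphabet} where
  open RankedAlphabet Sg

  HasOrder : Scheme Sg → ℕ → Set
  HasOrder G n = (∀ F → ord (nty F) ≤ n) × (∃[ F ] ord (nty F) ≡ n)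
    where open Scheme G

  module _ {N : ℕ} {nty : Fin N → Ty} where

    apps : ∀ {Γ A} → Term Sg nty Γ A → All (Term Sg nty Γ) (args A) → Term Sg nty Γ o
    apps {A = o}     t []       = t
    apps {A = _ ⇒ _} t (s ∷ ss) = apps (t · s) ss

    _[_] : ∀ {Γ Γ′ A} → Term Sg nty Γ A → All (Term Sg nty Γ′) Γ → Term Sg nty Γ′ A
    var x   [ σ ] = All.lookup σ x
    ter f   [ σ ] = ter f
    non F   [ σ ] = non F
    (t · s) [ σ ] = (t [ σ ]) · (s [ σ ])

  -- What a closed term has already produced: its nonterminals are read as
  -- the everywhere undefined tree.

  Val : Ty → Set
  Val o       = PartialTree Sg
  Val (A ⇒ B) = Val A → Val B

  undefinedVal : ∀ A → Val A
  undefinedVal o       = λ _ → nothing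
  undefinedVal (A ⇒ B) = λ _ → undefinedVal B

  node : ∀ f → Vec (PartialTree Sg) (arity f) → PartialTree Sg
  node f us []      = just f
  node f us (i ∷ p) with i <? arity f
  ... | yes i<k = Vec.lookup us (fromℕ< i<k) p
  ... | no  _   = nothing

  curryVal : ∀ k → (Vec (PartialTree Sg) k → PartialTree Sg) → Val (groundTy k)
  curryVal zero    g = g []
  curryVal (suc k) g = λ u → curryVal k (g ∘ (u ∷_))

  approximant : ∀ {N} {nty : Fin N → Ty} {A} → Term Sg nty [] A → Val A
  approximant             (ter f) = curryVal (arity f) (node f)
  approximant {nty = nty} (non F) = undefinedVal (nty F)
  approximant             (t · s) = approximant t (approximant s)

  module _ (G : Scheme Sg) where
    open Scheme G

    infix 4 _⟶_

    data _⟶_ : ∀ {A} → Term Sg nty [] A → Term Sg nty [] A → Set where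
      rewrite-rule : ∀ F (ts : All (Term Sg nty []) (args (nty F))) →
                     apps (non F) ts ⟶ rule F [ ts ]
      appˡ : ∀ {A B} {t t′ : Term Sg nty [] (A ⇒ B)} {s} → t ⟶ t′ → t · s ⟶ t′ · s
      appʳ : ∀ {A B} {t : Term Sg nty [] (A ⇒ B)} {s s′} → s ⟶ s′ → t · s ⟶ t · s′

    startTerm : Term Sg nty [] o
    startTerm = subst (Term Sg nty []) start-ty (non start)

    -- t is the least upper bound of the approximants of all terms reachable from
    -- the start symbol: in the pointwise order on partial trees, their union.
    Generates : Tree Sg → Set
    Generates t = ∀ p f →
      (Tree.label t p ≡ just f)
        ⇔ (∃[ e ] (Star _⟶_ startTerm e × approximant e p ≡ just f))

  -- An element of Δ is the list of types of the variables bound by one lambda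
  -- node, the list Δ being the lambda nodes on the path to the root, nearest
  -- first.  A variable is thus a lambda node on that path with an index into it.
  Var : List (List Ty) → Ty → Set
  Var Δ A = Any (A ∈_) Δ

  module _ {N : ℕ} (nty : Fin N → Ty) where

    -- Finite computation trees.  `LamTree Δ As` is rooted at a lambda node binding
    -- variables of types As (a dummy if As is empty), `NodeTree Δ` at any other
    -- node; `app` is the node @, whose first child is the tree of an abstraction.
    -- These are also exactly the η-long terms: passing from an η-long term to its
    -- computation tree only turns term formers into nodes.
    mutual
      data LamTree (Δ : List (List Ty)) (As : List Ty) : Set where
        ƛ : NodeTree (As ∷ Δ) → LamTree Δ As

      data NodeTree (Δ : List (List Ty)) : Set where
        var : ∀ {A} → Var Δ A → Subtrees Δ (args A) → NodeTree Δ
        ter : ∀ f → Subtrees Δ (args (groundTy (arity f))) → NodeTree Δ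
        non : ∀ F → Subtrees Δ (args (nty F)) → NodeTree Δ
        app : ∀ {A As} → LamTree Δ (A ∷ As) → Subtrees Δ (A ∷ As) → NodeTree Δ

      Subtrees : List (List Ty) → List Ty → Set
      Subtrees Δ = All (λ A → LamTree Δ (args A))

  lamOrd : List Ty → ℕ
  lamOrd []         = 0
  lamOrd As@(_ ∷ _) = suc (foldr _⊔_ 0 (map ord As))

  BoundByFirst : ∀ {Δ A} → Var Δ A → Set
  BoundByFirst {As ∷ _} {A} (here _)  = ord A < lamOrd As
  BoundByFirst {As ∷ _} {A} (there x) = ¬ (ord A < lamOrd As) × BoundByFirst x

  module _ {N : ℕ} {nty : Fin N → Ty} where

    mutual
      IncBound : ∀ {Δ As} → LamTree nty Δ As → Set
      IncBound (ƛ t) = IncBoundNode t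

      IncBoundNode : ∀ {Δ} → NodeTree nty Δ → Set
      IncBoundNode (var x ts) = BoundByFirst x × IncBoundAll ts
      IncBoundNode (ter f ts) = IncBoundAll ts
      IncBoundNode (non F ts) = IncBoundAll ts
      IncBoundNode (app t ts) = IncBound t × IncBoundAll ts

      IncBoundAll : ∀ {Δ As} → Subtrees nty Δ As → Set
      IncBoundAll []       = ⊤
      IncBoundAll (t ∷ ts) = IncBound t × IncBoundAll ts

    ηVars : ∀ {Δ} A → (∀ {B} → B ∈ args A → Var Δ B) → Subtrees nty Δ (args A)
    ηVars o       ρ = []
    ηVars (A ⇒ B) ρ = ƛ (var (there (ρ (here refl))) (ηVars A here)) ∷ ηVars B (ρ ∘ there)

    -- ηApp ρ t ts is the computation tree, without its root lambda, of the
    -- η-long form of t applied to ts.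
    mutual
      ηApp : ∀ {Γ Δ A} → (∀ {B} → B ∈ Γ → Var Δ B) →
             Term Sg nty Γ A → Subtrees nty Δ (args A) → NodeTree nty Δ
      ηApp ρ (var x) ts = var (ρ x) ts
      ηApp ρ (ter f) ts = ter f ts
      ηApp ρ (non F) ts = non F ts
      ηApp ρ (t · s) ts = ηApp ρ t (ηLong ρ s ∷ ts)

      ηLong : ∀ {Γ Δ A} → (∀ {B} → B ∈ Γ → Var Δ B) →
              Term Sg nty Γ A → LamTree nty Δ (args A)
      ηLong {A = A} ρ t = ƛ (ηApp (there ∘ ρ) t (ηVars A here))

    abstraction : ∀ {Δ As} → Term Sg nty As o → LamTree nty Δ As
    abstraction e = ƛ (ηApp here e [])

    -- Without parameters λ.e is just e, so no application node is created.
    applyAbstraction : ∀ {Δ As} → Term Sg nty As o → Subtrees nty Δ As → NodeTree nty Δ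
    applyAbstraction {As = []}    e []         = ηApp (λ ()) e []
    applyAbstraction {As = _ ∷ _} e ts@(_ ∷ _) = app (abstraction e) ts

  module _ (G : Scheme Sg) where
    open Scheme G

    mutual
      unfold : ∀ {Δ As} → LamTree nty Δ As → LamTree nty Δ As
      unfold (ƛ t) = ƛ (unfoldNode t)

      unfoldNode : ∀ {Δ} → NodeTree nty Δ → NodeTree nty Δ
      unfoldNode (var x ts) = var x (unfoldEach ts)
      unfoldNode (ter f ts) = ter f (unfoldEach ts)
      unfoldNode (non F ts) = applyAbstraction (rule F) (unfoldEach ts)
      unfoldNode (app t ts) = app (unfold t) (unfoldEach ts)

      unfoldEach : ∀ {Δ As} → Subtrees nty Δ As → Subtrees nty Δ As
      unfoldEach []       = []
      unfoldEach (t ∷ ts) = unfold t ∷ unfoldEach ts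

    nthUnfolding : ℕ → LamTree nty [] (args (nty start))
    nthUnfolding zero    = abstraction (rule start)
    nthUnfolding (suc k) = unfold (nthUnfolding k)

    IncrementallyBound : Set
    IncrementallyBound = ∀ k → IncBound (nthUnfolding k)

-- Stacks are written with the top element first.
Stack : Set → ℕ → Set
Stack Γ zero          = Γ
Stack Γ (suc zero)    = List Γ
Stack Γ (suc (suc k)) = List⁺ (Stack Γ (suc k))

-- The index is the order of the stack operated on.  On order n, pop_j is `pop`
-- and push_j (j ≥ 2) is `dup` at index j, wrapped in n - j occurrences of `top`.
data Op (Γ : Set) : ℕ → Set where
  push₁ : Γ → Op Γ 1
  pop   : ∀ {k} → Op Γ (suc k)
  dup   : ∀ {k} → Op Γ (suc (suc k))
  top   : ∀ {k} → Op Γ (suc k) → Op Γ (suc (suc k))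

-- `nothing` when pop_1 meets an empty stack, or when a pop would leave a stack
-- of order at least 2 empty.
applyOp : ∀ {Γ n} → Op Γ n → Stack Γ n → Maybe (Stack Γ n)
applyOp (push₁ a)     s        = just (a ∷ s)
applyOp (pop {zero})  []       = nothing
applyOp (pop {zero})  (_ ∷ s)  = just s
applyOp (pop {suc _}) (_ ∷ ss) = List⁺.fromList ss
applyOp dup           (s ∷ ss) = just (s ∷ s ∷ ss)
applyOp (top φ)       (s ∷ ss) = Maybe.map (_∷ ss) (applyOp φ s)

module _ {Γ : Set} (bottom : Γ) where

  emptyStack : ∀ n → Stack Γ n
  emptyStack zero          = bottom
  emptyStack (suc zero)    = []
  emptyStack (suc (suc k)) = emptyStack (suc k) ∷ []

  top₁ : ∀ n → Stack Γ n → Γ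
  top₁ zero          a        = a
  top₁ (suc zero)    []       = bottom
  top₁ (suc zero)    (a ∷ _)  = a
  top₁ (suc (suc k)) (s ∷ _)  = top₁ (suc k) s

module _ (Sg : RankedAlphabet) where
  open RankedAlphabet Sg

  record PDA (n : ℕ) : Set where
    field
      stackSymbols : ℕ
      bottom       : Fin stackSymbols
      states       : ℕ
      initial      : Fin states
      δ            : Fin states → Fin stackSymbols →
                     (Fin states × Op (Fin stackSymbols) n)
                       ⊎ (∃[ f ] Vec (Fin states) (arity f))

module _ {Sg : RankedAlphabet} {n : ℕ} (P : PDA Sg n) where
  open RankedAlphabet Sg
  open PDA P

  -- Outputs q s p f: the tree generated from state q and stack s has label f
  -- at position p.
  data Outputs (q : Fin states) (s : Stack (Fin stackSymbols) n) :
               List ℕ → Symbol → Set where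
    move  : ∀ {q′ φ s′ p f} → δ q (top₁ bottom n s) ≡ inj₁ (q′ , φ) →
            applyOp φ s ≡ just s′ → Outputs q′ s′ p f → Outputs q s p f
    root  : ∀ {f qs} → δ q (top₁ bottom n s) ≡ inj₂ (f , qs) → Outputs q s [] f
    child : ∀ {f qs p g} → δ q (top₁ bottom n s) ≡ inj₂ (f , qs) →
            (i : Fin (arity f)) → Outputs (Vec.lookup qs i) s p g →
            Outputs q s (toℕ i ∷ p) g

  Accepts : Tree Sg → Set
  Accepts t = ∀ p f →
    (Tree.label t p ≡ just f) ⇔ Outputs initial (emptyStack bottom n) p f

module Submission where

-- Both models are compared through head reduction of closed terms, with the
-- number of unfolded nonterminals as a step index for logical relations.
--
-- In an applicative term, incremental binding says that an operand of order l
-- contains only variables of order at least l.  Given such a scheme, the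
-- automaton evaluates the η-long rule bodies with environments: a stack symbol
-- is a node of a rule body, and the symbols below it are the nodes above it in
-- the rule body and then, for a rule body, its caller.  To enter the operand
-- bound to a variable of order l ≥ 1, the topmost order-(n - l) stack is copied
-- first.  Climbing to the operand passes only binders of order at most l and
-- pops inside this copy only; the parameters of the operand are found again by
-- popping the copy.  So pop_(n - k + 1) leads from a binder of order k to its
-- caller, and no links are needed.
--
-- Conversely, a state q and an order-k stack with topmost order-(k - 1) stack t
-- become the term for q and t applied to the terms, one for each state, for the
-- stack that remains when t is popped.  All operands that arise are safe.

open import Data.Empty using (⊥; ⊥-elim)
open import Data.Fin using (Fin; zero; suc; toℕ; fromℕ<; inject₁; combine; remQuot; splitAt; _↑ˡ_; _↑ʳ_)
open import Data.Fin.Properties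
  using (toℕ<n; toℕ-fromℕ<; fromℕ<-toℕ; toℕ-inject₁; remQuot-combine; splitAt-↑ˡ; splitAt-↑ʳ)
open import Data.List as List using (List; []; _∷_; _++_; length; lookup; concatMap; allFin)
open import Data.List.Membership.Propositional using (_∈_)
open import Data.List.Membership.Propositional.Properties
  using (∈-++⁺ˡ; ∈-++⁺ʳ; ∈-++⁻; ∈-concatMap⁺; ∈-concatMap⁻; ∈-allFin; ∈-lookup)
open import Data.List.NonEmpty using (_∷_)
open import Data.List.Relation.Unary.All as All using (All; []; _∷_)
open import Data.List.Relation.Unary.Any as Any using (Any; here; there; index)
open import Data.List.Relation.Unary.Any.Properties using (lookup-index)
open import Data.Maybe as Maybe using (Maybe; just; nothing)
open import Data.Nat using (ℕ; zero; suc; _+_; _*_; _∸_; _⊓_; _⊔_; _≤_; _<_; z≤n; s≤s; _<?_)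
open import Data.Nat.ListAction using (sum)
open import Data.Nat.Properties
  using (≤-refl; ≤-trans; ≤-reflexive; ≤-pred; <⇒≤; ≤-<-trans; ≮⇒≥; ≤⇒≯; n≮n; n≤1+n;
         m≤m+n; m≤n+m; ∸-monoˡ-≤; m⊓n≤m; m⊓n≤n; m≤n⇒m⊓n≡m;
         m≤m⊔n; m≤n⊔m; m≥n⇒m⊔n≡m; ⊔-idem; ⊔-identityʳ; ⊔-lub; ⊔-monoˡ-≤)
open import Data.Product using (∃-syntax; Σ-syntax; _×_; _,_; proj₁; proj₂)
open import Data.Sum using (_⊎_; inj₁; inj₂; [_,_]′)
open import Data.Unit using (⊤; tt)
open import Data.Vec as Vec using (Vec; []; _∷_)
open import Data.Vec.Properties using (lookup-map; lookup∘tabulate)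
open import Function using (_∘_; _⇔_; mk⇔; Equivalence)
open import Function.Properties.Equivalence using () renaming (sym to ⇔-sym; trans to ⇔-trans)
open import Relation.Binary.Construct.Closure.ReflexiveTransitive using (Star; ε; _◅_; gmap)
open import Relation.Binary.PropositionalEquality using (_≡_; refl; sym; trans; cong; cong₂; subst)
open import Relation.Nullary using (¬_; yes; no; contradiction)
open import Defs

open Equivalence using (to; from)

-- Head reduction of applicative terms

groundArg : ∀ {P : Ty → Set} k → All P (args (groundTy k)) → Fin k → P o
groundArg (suc k) (t ∷ ts) zero    = t
groundArg (suc k) (t ∷ ts) (suc i) = groundArg k ts i

module HeadReduction {Sg : RankedAlphabet} (G : Scheme Sg) where
  open RankedAlphabet Sg
  open Scheme G

  Closed : Ty → Set
  Closed = Term Sg nty []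

  -- Head reduction of t applied to ts, with at most m unfoldings of
  -- nonterminals on the way to the node at the given position.
  data Out : ℕ → ∀ {A} → Closed A → All Closed (args A) → List ℕ → Symbol → Set where
    app   : ∀ {m A B} {t : Closed (A ⇒ B)} {s ts p f} →
            Out m t (s ∷ ts) p f → Out m (t · s) ts p f
    non   : ∀ {m F ts p f} → Out m (rule F [ ts ]) [] p f → Out (suc m) (non F) ts p f
    root  : ∀ {m f ts} → Out m (ter f) ts [] f
    child : ∀ {m f ts p g} (i : Fin (arity f)) →
            Out m (groundArg (arity f) ts i) [] p g → Out m (ter f) ts (toℕ i ∷ p) g

  Produces : Closed o → List ℕ → Symbol → Set
  Produces t p f = ∃[ e ] (Star (_⟶_ G) t e × approximant e p ≡ just f)

  groundVals : ∀ k → All Closed (args (groundTy k)) → Vec (PartialTree Sg) k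
  groundVals zero    []       = []
  groundVals (suc k) (t ∷ ts) = approximant t ∷ groundVals k ts

  groundVals-lookup : ∀ k ts i →
    Vec.lookup (groundVals k ts) i ≡ approximant (groundArg k ts i)
  groundVals-lookup (suc k) (t ∷ ts) zero    = refl
  groundVals-lookup (suc k) (t ∷ ts) (suc i) = groundVals-lookup k ts i

  approximant-apps : ∀ k (t : Closed (groundTy k)) {h} → approximant t ≡ curryVal k h →
    ∀ ts → approximant (apps t ts) ≡ h (groundVals k ts)
  approximant-apps zero    t eq []       = eq
  approximant-apps (suc k) t eq (s ∷ ts) =
    approximant-apps k (t · s) (cong (λ v → v (approximant s)) eq) ts

  approximant-ter : ∀ f ts →
    approximant (apps (ter f) ts) ≡ node {Sg} f (groundVals (arity f) ts)
  approximant-ter f = approximant-apps (arity f) (ter f) refl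

  node-child : ∀ f us (i : Fin (arity f)) p → node {Sg} f us (toℕ i ∷ p) ≡ Vec.lookup us i p
  node-child f us i p with toℕ i <? arity f
  ... | yes i<k = cong (λ j → Vec.lookup us j p) (fromℕ<-toℕ i i<k)
  ... | no  i≮k = contradiction (toℕ<n i) i≮k

  apps-cong : ∀ A {t t′ : Closed A} ts → Star (_⟶_ G) t t′ → Star (_⟶_ G) (apps t ts) (apps t′ ts)
  apps-cong o       []       r = r
  apps-cong (A ⇒ B) (s ∷ ts) r = apps-cong B ts (gmap (_· s) appˡ r)

  rewriteArg : ∀ k {t : Closed (groundTy k)} ts i {e} → Star (_⟶_ G) (groundArg k ts i) e →
    ∃[ ts′ ] (Star (_⟶_ G) (apps t ts) (apps t ts′) × groundArg k ts′ i ≡ e)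
  rewriteArg (suc k) (s ∷ ts) zero    {e} r =
    e ∷ ts , apps-cong (groundTy k) ts (gmap (_ ·_) appʳ r) , refl
  rewriteArg (suc k) (s ∷ ts) (suc i) r with rewriteArg k ts i r
  ... | ts′ , r′ , eq = s ∷ ts′ , r′ , eq

  Out⇒Produces : ∀ {m A} {t : Closed A} {ts p f} → Out m t ts p f → Produces (apps t ts) p f
  Out⇒Produces (app d) = Out⇒Produces d
  Out⇒Produces (non {F = F} {ts} d) with Out⇒Produces d
  ... | e , r , eq = e , rewrite-rule F ts ◅ r , eq
  Out⇒Produces (root {f = f} {ts}) = _ , ε , cong (λ v → v []) (approximant-ter f ts)
  Out⇒Produces (child {f = f} {ts} {p} i d) with Out⇒Produces d
  ... | e , r , eq with rewriteArg (arity f) {ter f} ts i r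
  ... | ts′ , r′ , eq′ = _ , r′ , trans (cong (λ v → v (toℕ i ∷ p)) (approximant-ter f ts′))
        (trans (node-child f (groundVals (arity f) ts′) i p)
        (trans (cong (λ v → v p) (groundVals-lookup (arity f) ts′ i))
        (trans (cong (λ s → approximant s p) eq′) eq)))

  -- Approximants as head reduction without unfolding.

  approximant-undefined : ∀ A {t : Closed A} → approximant t ≡ undefinedVal A →
    ∀ ts p → approximant (apps t ts) p ≡ nothing
  approximant-undefined o       eq []       p = cong (λ v → v p) eq
  approximant-undefined (A ⇒ B) eq (s ∷ ts) p =
    approximant-undefined B (cong (λ v → v (approximant s)) eq) ts p

  -- With nonterminals undefined, a ground term is defined somewhere only if its head is a terminal,
  -- and the operands of terminals are ground. So nothing has to be claimed at function types.
  Adequate : ∀ {A} → Closed A → Set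
  Adequate {o}     t = ∀ {p f} → approximant t p ≡ just f → Out 0 t [] p f
  Adequate {_ ⇒ _} _ = ⊤

  AdequateArgs : ∀ A → All Closed (args A) → Set
  AdequateArgs o       []       = ⊤
  AdequateArgs (A ⇒ B) (t ∷ ts) = Adequate t × AdequateArgs B ts

  groundAdequate : ∀ k {ts} → AdequateArgs (groundTy k) ts → ∀ i → Adequate (groundArg k ts i)
  groundAdequate (suc k) {t ∷ ts} (s , ss) zero    = s
  groundAdequate (suc k) {t ∷ ts} (s , ss) (suc i) = groundAdequate k ss i

  mutual
    adequate : ∀ {A} (t : Closed A) → Adequate t
    adequate {o}     t eq = adequate-apps t [] tt eq
    adequate {_ ⇒ _} t    = tt

    adequate-apps : ∀ {A} (t : Closed A) ts → AdequateArgs A ts →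
      ∀ {p f} → approximant (apps t ts) p ≡ just f → Out 0 t ts p f
    adequate-apps (t · s) ts ss eq = app (adequate-apps t (s ∷ ts) (adequate s , ss) eq)
    adequate-apps (non F) ts ss {p} eq
      with () ← trans (sym (approximant-undefined (nty F) {non F} refl ts p)) eq
    adequate-apps (ter f) ts ss {[]} eq
      with refl ← trans (sym (cong (λ v → v []) (approximant-ter f ts))) eq = root
    adequate-apps (ter f) ts ss {i ∷ p} {g} eq
      with eq′ ← trans (sym (cong (λ v → v (i ∷ p)) (approximant-ter f ts))) eq
      with i <? arity f
    ... | yes i<k = subst (λ j → Out 0 (ter f) ts (j ∷ p) g) (toℕ-fromℕ< i<k)
          (child (fromℕ< i<k) (groundAdequate (arity f) ss (fromℕ< i<k)
            (trans (cong (λ v → v p) (sym (groundVals-lookup (arity f) ts (fromℕ< i<k)))) eq′)))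
    ... | no  _ with () ← eq′

  -- A step-indexed simulation for rewriting.

  mutual
    -- The index bounds the unfoldings of `t′` only. A rewriting step inside an operand may have to
    -- be repeated at every use of that operand, so `t` is allowed any number.
    Sim : ℕ → ∀ A → Closed A → Closed A → Set
    Sim k A t t′ = ∀ {j} → j ≤ k → ∀ {ts ts′} → SimArgs j A ts ts′ →
      ∀ {p f} → Out j t′ ts′ p f → ∃[ m ] Out m t ts p f

    SimArgs : ℕ → ∀ A → All Closed (args A) → All Closed (args A) → Set
    SimArgs k o       []       []         = ⊤
    SimArgs k (A ⇒ B) (t ∷ ts) (t′ ∷ ts′) = Sim k A t t′ × SimArgs k B ts ts′

  Sim-mono : ∀ {j k A t t′} → j ≤ k → Sim k A t t′ → Sim j A t t′
  Sim-mono j≤k sim i≤j = sim (≤-trans i≤j j≤k)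

  SimArgs-lookup : ∀ {k} A {ts ts′} → SimArgs k A ts ts′ →
    ∀ {B} (x : B ∈ args A) → Sim k B (All.lookup ts x) (All.lookup ts′ x)
  SimArgs-lookup (A ⇒ B) {t ∷ ts} {t′ ∷ ts′} (s , ss) (here refl) = s
  SimArgs-lookup (A ⇒ B) {t ∷ ts} {t′ ∷ ts′} (s , ss) (there x)   = SimArgs-lookup B ss x

  SimArgs-ground : ∀ {j} k {ts ts′} → SimArgs j (groundTy k) ts ts′ →
    ∀ i → Sim j o (groundArg k ts i) (groundArg k ts′ i)
  SimArgs-ground (suc k) {t ∷ ts} {t′ ∷ ts′} (s , ss) zero    = s
  SimArgs-ground (suc k) {t ∷ ts} {t′ ∷ ts′} (s , ss) (suc i) = SimArgs-ground k ss i

  -- The fundamental lemma. Unfolding a nonterminal lowers the index by one, which gives access to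
  -- the statement for its rule; recursion is on `K` first and on the term second.
  Sim-subst : ∀ K {k} → k ≤ K → ∀ {Γ A} (t : Term Sg nty Γ A) {σ σ′ : All Closed Γ} →
    (∀ {B} (x : B ∈ Γ) → Sim k B (All.lookup σ x) (All.lookup σ′ x)) →
    Sim k A (t [ σ ]) (t [ σ′ ])
  Sim-subst K k≤K (var x) σ~ = σ~ x
  Sim-subst K k≤K (ter f) σ~ j≤k ss root        = 0 , root
  Sim-subst K k≤K (ter f) σ~ j≤k ss (child i d)
    with SimArgs-ground (arity f) ss i ≤-refl {[]} {[]} tt d
  ... | m , d′ = m , child i d′
  Sim-subst (suc K) k≤K (non F) σ~ j<k ss (non d) with s≤s j≤K ← ≤-trans j<k k≤K
    with Sim-subst K j≤K (rule F) (λ x → Sim-mono (n≤1+n _) (SimArgs-lookup (nty F) ss x))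
           ≤-refl {[]} {[]} tt d
  ... | m , d′ = suc m , non d′
  Sim-subst zero z≤n (non F) σ~ () ss (non d)
  Sim-subst K k≤K (t · s) σ~ j≤k ss (app d)
    with Sim-subst K k≤K t σ~ j≤k (Sim-mono j≤k (Sim-subst K k≤K s σ~) , ss) d
  ... | m , d′ = m , app d′

  subst-closed : ∀ {A} (t : Closed A) → t [ [] ] ≡ t
  subst-closed (ter f) = refl
  subst-closed (non F) = refl
  subst-closed (t · s) = cong₂ _·_ (subst-closed t) (subst-closed s)

  Sim-refl : ∀ k {A} (t : Closed A) → Sim k A t t
  Sim-refl k {A} t = subst (λ s → Sim k A s s) (subst-closed t)
    (Sim-subst k ≤-refl t {[]} {[]} λ ())

  Out-apps : ∀ {m} A {t : Closed A} ts {p f} → Out m t ts p f → Out m (apps t ts) [] p f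
  Out-apps o       []       d = d
  Out-apps (A ⇒ B) (s ∷ ts) d = Out-apps B ts (app d)

  -- The redex itself costs one unfolding. A step in an operand is handled by reflexivity of the
  -- function part, applied to related operands, so no residuals are traced.
  Sim-step : ∀ {k A t t′} → _⟶_ G {A} t t′ → Sim k A t t′
  Sim-step (rewrite-rule F ts) j≤k {[]} {[]} tt d = _ , Out-apps (nty F) ts (non d)
  Sim-step (appˡ {s = s} r) j≤k ss (app d)
    with Sim-step r j≤k (Sim-refl _ s , ss) d
  ... | m , d′ = m , app d′
  Sim-step (appʳ {t = t} r) j≤k ss (app d)
    with Sim-refl _ t ≤-refl (Sim-step r , ss) d
  ... | m , d′ = m , app d′

  -- The last approximant is a run without unfoldings; it is pulled back through the rewriting steps
  -- one at a time.
  Produces⇒Out : ∀ {t : Closed o} {p f} → Produces t p f → ∃[ m ] Out m t [] p f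
  Produces⇒Out (e , ε , eq)     = 0 , adequate e eq
  Produces⇒Out (e , r ◅ rs , eq) with Produces⇒Out (e , rs , eq)
  ... | m , d = Sim-step r ≤-refl {[]} {[]} tt d

  Produces⇔Out : ∀ {t p f} → Produces t p f ⇔ (∃[ m ] Out m t [] p f)
  Produces⇔Out = mk⇔ Produces⇒Out (Out⇒Produces ∘ proj₂)

-- Evaluation of computation trees with environments

module TreeMachine {Sg : RankedAlphabet} (G : Scheme Sg) where
  open RankedAlphabet Sg
  open Scheme G
  open HeadReduction G

  Lam : List (List Ty) → List Ty → Set
  Lam = LamTree {Sg} nty

  Node : List (List Ty) → Set
  Node = NodeTree {Sg} nty

  Subs : List (List Ty) → List Ty → Set
  Subs = Subtrees {Sg} nty

  lamBody : ∀ {Δ As} → Lam Δ As → Node (As ∷ Δ)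
  lamBody (ƛ u) = u

  mutual
    data Env : List (List Ty) → Set where
      []  : Env []
      _∷_ : ∀ {As Δ} → Frame As → Env Δ → Env (As ∷ Δ)

    data Frame (As : List Ty) : Set where
      frame : ∀ {Δ} → Subs Δ As → Env Δ → Frame As

  data Closure (A : Ty) : Set where
    closure : ∀ {Δ} → Lam Δ (args A) → Env Δ → Closure A

  Conf : Set
  Conf = ∃[ Δ ] (Node Δ × Env Δ)

  lookupVar : ∀ {Δ A} → Env Δ → Var {Sg} Δ A → Closure A
  lookupVar (frame ts E′ ∷ E) (here x)  = closure (All.lookup ts x) E′
  lookupVar (_ ∷ E)           (there x) = lookupVar E x

  enter : ∀ {A} → Closure A → Frame (args A) → Conf
  enter (closure t E) φ = _ , lamBody t , φ ∷ E

  body : ∀ F → Node (args (nty F) ∷ [])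
  body F = ηApp here (rule F) []

  -- As in `Out`, only calls of nonterminals are counted. Variable lookups, which substitution
  -- performs silently, are free, so both kinds of run can be compared at equal index.
  data TOut : ℕ → Conf → List ℕ → Symbol → Set where
    var   : ∀ {m Δ A} {x : Var {Sg} Δ A} {ts E p f} →
            TOut m (enter (lookupVar E x) (frame ts E)) p f → TOut m (Δ , var x ts , E) p f
    non   : ∀ {m Δ F ts E p f} → TOut m (_ , body F , frame ts E ∷ []) p f →
            TOut (suc m) (Δ , non F ts , E) p f
    root  : ∀ {m Δ f ts E} → TOut m (Δ , ter f ts , E) [] f
    child : ∀ {m Δ f ts E p g} (i : Fin (arity f)) →
            TOut m (enter {o} (closure (groundArg (arity f) ts i) E) (frame [] E)) p g →
            TOut m (Δ , ter f ts , E) (toℕ i ∷ p) g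

  mutual
    Rel : ℕ → ∀ A → Closure A → Closed A → Set
    Rel k A c t = ∀ {j} → j ≤ k → ∀ {Δ} {ts : Subs Δ (args A)} {E ss} →
      RelArgs j A ts E ss → ∀ {p f} → TOut j (enter c (frame ts E)) p f ⇔ Out j t ss p f

    RelArgs : ℕ → ∀ A {Δ} → Subs Δ (args A) → Env Δ → All Closed (args A) → Set
    RelArgs k o       []       E []       = ⊤
    RelArgs k (A ⇒ B) (t ∷ ts) E (s ∷ ss) = Rel k A (closure t E) s × RelArgs k B ts E ss

  Rel-mono : ∀ {j k A c t} → j ≤ k → Rel k A c t → Rel j A c t
  Rel-mono j≤k rel i≤j = rel (≤-trans i≤j j≤k)

  RelArgs-lookup : ∀ {k} A {Δ} {ts : Subs Δ (args A)} {E ss} → RelArgs k A ts E ss →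
    ∀ {B} (x : B ∈ args A) → Rel k B (closure (All.lookup ts x) E) (All.lookup ss x)
  RelArgs-lookup (A ⇒ B) {ts = _ ∷ _} {ss = _ ∷ _} (r , rs) (here refl) = r
  RelArgs-lookup (A ⇒ B) {ts = _ ∷ _} {ss = _ ∷ _} (r , rs) (there x)   = RelArgs-lookup B rs x

  RelArgs-ground : ∀ {j} k {Δ} {ts : Subs Δ (args (groundTy k))} {E ss} →
    RelArgs j (groundTy k) ts E ss →
    ∀ i → Rel j o (closure (groundArg k ts i) E) (groundArg k ss i)
  RelArgs-ground (suc k) {ts = _ ∷ _} {ss = _ ∷ _} (r , rs) zero    = r
  RelArgs-ground (suc k) {ts = _ ∷ _} {ss = _ ∷ _} (r , rs) (suc i) = RelArgs-ground k rs i

  TOut-var : ∀ {m Δ A} {x : Var {Sg} Δ A} {ts E p f} →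
    TOut m (Δ , var x ts , E) p f ⇔ TOut m (enter (lookupVar E x) (frame ts E)) p f
  TOut-var = mk⇔ (λ { (var d) → d }) var

  mutual
    -- Entering an η-expanded variable is a detour to the closure of that variable. The operands
    -- passed on are again η-expanded variables, at the smaller types in `args A`.
    Rel-η : ∀ {k} A {Δ E} (x : Var {Sg} Δ A) {t} → Rel k A (lookupVar E x) t →
      Rel k A (closure (ƛ (var (there x) (ηVars A here))) E) t
    Rel-η A {E = E} x r j≤k {ts = ts} {E′} rs =
      ⇔-trans TOut-var (r j≤k (RelArgs-ηVars A {E = frame ts E′ ∷ E} here (RelArgs-lookup A rs)))

    RelArgs-ηVars : ∀ {k} A {Δ E} (ρ : ∀ {B} → B ∈ args A → Var {Sg} Δ B) {ss} →
      (∀ {B} (x : B ∈ args A) → Rel k B (lookupVar E (ρ x)) (All.lookup ss x)) →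
      RelArgs k A (ηVars A ρ) E ss
    RelArgs-ηVars o       ρ {[]}     rs = tt
    RelArgs-ηVars (A ⇒ B) ρ {s ∷ ss} rs =
      Rel-η A (ρ (here refl)) (rs (here refl)) , RelArgs-ηVars B (ρ ∘ there) (rs ∘ there)

  RelEnv : ℕ → ∀ {Γ Δ} → (∀ {B} → B ∈ Γ → Var {Sg} Δ B) → Env Δ → All Closed Γ → Set
  RelEnv k {Γ} ρ E σ = ∀ {B} (x : B ∈ Γ) → Rel k B (lookupVar E (ρ x)) (All.lookup σ x)

  -- The fundamental lemma, with the two-level recursion of `Sim-subst`. An operand is η-long, so on
  -- entry its environment grows by the frame for its own lambda node; this is why `ρ` is shifted.
  Rel-ηApp : ∀ K {j} → j ≤ K → ∀ {Γ Δ A} (t : Term Sg nty Γ A)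
    (ρ : ∀ {B} → B ∈ Γ → Var {Sg} Δ B) {E σ} → RelEnv j ρ E σ →
    ∀ {ts ss} → RelArgs j A ts E ss →
    ∀ {p f} → TOut j (_ , ηApp ρ t ts , E) p f ⇔ Out j (t [ σ ]) ss p f
  Rel-ηApp K j≤K (var x) ρ σ~ rs = ⇔-trans TOut-var (σ~ x ≤-refl rs)
  Rel-ηApp K j≤K {A = A} (ter f) ρ σ~ {ts} {ss} rs = mk⇔
    (λ { root        → root
       ; (child i d) → child i (to (RelArgs-ground (arity f) rs i ≤-refl {ts = []} {ss = []} tt) d) })
    (λ { root        → root
       ; (child i d) → child i (from (RelArgs-ground (arity f) rs i ≤-refl {ts = []} {ss = []} tt) d) })
  Rel-ηApp zero    z≤n       (non F) ρ σ~ rs = mk⇔ (λ ()) (λ ())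
  Rel-ηApp (suc K) {zero} _  (non F) ρ σ~ rs = mk⇔ (λ ()) (λ ())
  Rel-ηApp (suc K) (s≤s j≤K) (non F) ρ {E} {σ} σ~ {ts} {ss} rs {p} {f} = mk⇔
    (λ { (non d) → non (to IH d) }) (λ { (non d) → non (from IH d) })
    where
    IH : TOut _ (_ , body F , frame ts E ∷ []) p f ⇔ Out _ (rule F [ ss ]) [] p f
    IH = Rel-ηApp K j≤K (rule F) here
      (λ x → Rel-mono {c = closure (All.lookup ts x) E} (n≤1+n _) (RelArgs-lookup (nty F) rs x))
      {[]} {[]} tt
  Rel-ηApp K {j} j≤K (_·_ {A} t s) ρ {E} {σ} σ~ {ts} {ss} rs {p} {f} =
    ⇔-trans (Rel-ηApp K j≤K t ρ {E} {σ} σ~ {ss = (s [ σ ]) ∷ ss} (operand , rs))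
      (mk⇔ app (λ { (app d) → d }))
    where
    operand : Rel j A (closure (ηLong ρ s) E) (s [ σ ])
    operand i≤j {ts = ts′} {E′} rs′ = Rel-ηApp K (≤-trans i≤j j≤K) s (there ∘ ρ)
      (λ x → Rel-mono {c = lookupVar E (ρ x)} i≤j (σ~ x))
      (RelArgs-ηVars A {E = frame ts′ E′ ∷ E} here (RelArgs-lookup A rs′))

  startArgs : ∀ {A} {P : Ty → Set} → A ≡ o → All P (args A)
  startArgs refl = []

  startConf : Conf
  startConf = _ , body start , frame {Δ = []} (startArgs start-ty) [] ∷ []

  Out-start : ∀ {m A p f} (eq : A ≡ o) {t : Closed A} →
    Out m (subst (Term Sg nty []) eq t) [] p f ⇔ Out m t (startArgs eq) p f
  Out-start refl = mk⇔ (λ d → d) (λ d → d)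

  RelArgs-start : ∀ {k A} (eq : A ≡ o) → RelArgs k A {[]} (startArgs eq) [] (startArgs eq)
  RelArgs-start refl = tt

  TOut⇔Out : ∀ {p f} → (∃[ m ] TOut m startConf p f) ⇔ (∃[ m ] Out m (startTerm G) [] p f)
  TOut⇔Out = mk⇔
    (λ (m , d) → suc m , from (Out-start start-ty) (non (to IH d)))
    (λ (m , d) → case-non (to (Out-start start-ty) d))
    where
    IH : ∀ {m p f} → TOut m startConf p f ⇔ Out m (rule start [ startArgs start-ty ]) [] p f
    IH {m} = Rel-ηApp m ≤-refl (rule start) here
      (RelArgs-lookup (nty start) (RelArgs-start start-ty)) {[]} {[]} tt

    case-non : ∀ {m p f} → Out m (non start) (startArgs start-ty) p f → ∃[ m ] TOut m startConf p f
    case-non (non d) = _ , from IH d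

-- Safety

ord-arg : ∀ A {B} → B ∈ args A → ord B < ord A
ord-arg (A ⇒ B) (here refl) = m≤m⊔n (suc (ord A)) (ord B)
ord-arg (A ⇒ B) (there x)   = ≤-trans (ord-arg B x) (m≤n⊔m (suc (ord A)) (ord B))

module Safety {Sg : RankedAlphabet} (G : Scheme Sg) where
  open RankedAlphabet Sg
  open Scheme G
  open TreeMachine G

  Tm : List Ty → Ty → Set
  Tm = Term Sg nty

  Bound : ∀ {Δ A} → Var {Sg} Δ A → Set
  Bound = BoundByFirst {Sg}

  lamOrd-args : ∀ A → lamOrd {Sg} (args A) ≡ ord A
  lamOrd-args o           = refl
  lamOrd-args (A ⇒ o)     = cong suc (⊔-identityʳ (ord A))
  lamOrd-args (A ⇒ B ⇒ C) = cong (suc (ord A) ⊔_) (lamOrd-args (B ⇒ C))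

  ord<lamOrd : ∀ A {B} → B ∈ args A → ord B < lamOrd {Sg} (args A)
  ord<lamOrd A {B} x = subst (ord B <_) (sym (lamOrd-args A)) (ord-arg A x)

  AllVars : ∀ {Γ} → (∀ {B} → B ∈ Γ → Set) → ∀ {A} → Tm Γ A → Set
  AllVars Q (var x) = Q x
  AllVars Q (ter f) = ⊤
  AllVars Q (non F) = ⊤
  AllVars Q (t · s) = AllVars Q t × AllVars Q s

  AllVars-zip : ∀ {Γ} {P Q R : ∀ {B} → B ∈ Γ → Set} → (∀ {B} (x : B ∈ Γ) → P x → Q x → R x) →
    ∀ {A} (t : Tm Γ A) → AllVars P t → AllVars Q t → AllVars R t
  AllVars-zip h (var x) p        q        = h x p q
  AllVars-zip h (ter f) _        _        = tt
  AllVars-zip h (non F) _        _        = tt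
  AllVars-zip h (t · s) (p , p′) (q , q′) = AllVars-zip h t p q , AllVars-zip h s p′ q′

  AllVars-map : ∀ {Γ} {P Q : ∀ {B} → B ∈ Γ → Set} → (∀ {B} (x : B ∈ Γ) → P x → Q x) →
    ∀ {A} (t : Tm Γ A) → AllVars P t → AllVars Q t
  AllVars-map h t p = AllVars-zip (λ x p _ → h x p) t p p

  AllVars-universal : ∀ {Γ} {P : ∀ {B} → B ∈ Γ → Set} → (∀ {B} (x : B ∈ Γ) → P x) →
    ∀ {A} (t : Tm Γ A) → AllVars P t
  AllVars-universal h (var x) = h x
  AllVars-universal h (ter f) = tt
  AllVars-universal h (non F) = tt
  AllVars-universal h (t · s) = AllVars-universal h t , AllVars-universal h s

  Vars≥ : ℕ → ∀ {Γ A} → Tm Γ A → Set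
  Vars≥ ℓ = AllVars (λ {B} _ → ℓ ≤ ord B)

  -- Incremental binding read off the applicative term: a lambda node of the
  -- computation tree is introduced by an operand and has the order of the
  -- operand, which must therefore not exceed the order of a variable in it.
  Safe : (Fin size → Set) → ∀ {Γ A} → Tm Γ A → Set
  Safe P (var x)       = ⊤
  Safe P (ter f)       = ⊤
  Safe P (non F)       = P F
  Safe P (_·_ {A} t s) = Safe P t × Safe P s × Vars≥ (ord A) s

  mutual
    -- Incremental binding of a rule body before any unfolding, hence without `app`. The predicate
    -- `P` records at each call what will be known about the rule called.
    GoodNode : (Fin size → Set) → ∀ {Δ} → Node Δ → Set
    GoodNode P (var x ts) = Bound x × GoodAll P ts
    GoodNode P (ter f ts) = GoodAll P ts
    GoodNode P (non F ts) = P F × GoodAll P ts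
    GoodNode P (app t ts) = ⊥

    GoodLam : (Fin size → Set) → ∀ {Δ As} → Lam Δ As → Set
    GoodLam P (ƛ u) = GoodNode P u

    GoodAll : (Fin size → Set) → ∀ {Δ As} → Subs Δ As → Set
    GoodAll P []       = ⊤
    GoodAll P (t ∷ ts) = GoodLam P t × GoodAll P ts

  mutual
    -- The new lambda node has exactly the order of the variable, so the search for the binder
    -- passes it. The variables it binds have smaller order, so for them the search stops there.
    good-η : ∀ {P} A {Δ} (x : Var {Sg} Δ A) → Bound x →
      GoodLam P {Δ} {args A} (ƛ (var (there x) (ηVars A here)))
    good-η A x b = ((λ lt → ≤⇒≯ (≤-reflexive (lamOrd-args A)) lt) , b) ,
      good-ηVars A here (ord<lamOrd A)

    good-ηVars : ∀ {P} A {Δ} (ρ : ∀ {B} → B ∈ args A → Var {Sg} Δ B) →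
      (∀ {B} (x : B ∈ args A) → Bound (ρ x)) → GoodAll P (ηVars A ρ)
    good-ηVars o       ρ b = tt
    good-ηVars (A ⇒ B) ρ b = good-η A (ρ (here refl)) (b (here refl)) ,
      good-ηVars B (ρ ∘ there) (b ∘ there)

  good-ηApp : ∀ {P Γ Δ A} (ρ : ∀ {B} → B ∈ Γ → Var {Sg} Δ B) (t : Tm Γ A) {ts} →
    Safe P t → AllVars (Bound ∘ ρ) t → GoodAll P ts → GoodNode P (ηApp ρ t ts)
  good-ηApp ρ (var x) s b gs = b , gs
  good-ηApp ρ (ter f) s b gs = gs
  good-ηApp ρ (non F) s b gs = s , gs
  good-ηApp ρ (_·_ {A} t r) (s , s′ , v) (b , b′) gs = good-ηApp ρ t s b
    (good-ηApp (there ∘ ρ) r s′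
      (AllVars-zip (λ x ℓ≤ b → (λ lt → ≤⇒≯ (≤-trans (≤-reflexive (lamOrd-args A)) ℓ≤) lt) , b) r v b′)
      (good-ηVars A here (ord<lamOrd A)) , gs)

  good-body : ∀ {P} F → Safe P (rule F) → GoodNode P (body F)
  good-body F s = good-ηApp here (rule F) s
    (AllVars-universal (ord<lamOrd (nty F)) (rule F)) tt

  mutual
    good⇒incBoundNode : ∀ {P Δ} (u : Node Δ) → GoodNode P u → IncBoundNode u
    good⇒incBoundNode (var x ts) (b , gs) = b , good⇒incBoundAll ts gs
    good⇒incBoundNode (ter f ts) gs       = good⇒incBoundAll ts gs
    good⇒incBoundNode (non F ts) (_ , gs) = good⇒incBoundAll ts gs

    good⇒incBoundAll : ∀ {P Δ As} (ts : Subs Δ As) → GoodAll P ts → IncBoundAll ts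
    good⇒incBoundAll []         _        = tt
    good⇒incBoundAll (ƛ u ∷ ts) (g , gs) = good⇒incBoundNode u g , good⇒incBoundAll ts gs

  module _ {P : Fin size → Set} (safe : ∀ F → Safe P (rule F)) where

    incBound-abstraction : ∀ {Δ} A (e : Tm (args A) o) → Safe P e →
      IncBound (abstraction {nty = nty} {Δ = Δ} e)
    incBound-abstraction A e s = good⇒incBoundNode (ηApp here e [])
      (good-ηApp here e s (AllVars-universal (ord<lamOrd A) e) tt)

    incBound-applyAbstraction : ∀ {Δ} A (e : Tm (args A) o) → Safe P e → (ts : Subs Δ (args A)) →
      IncBoundAll ts → IncBoundNode (applyAbstraction e ts)
    -- A body without parameters is placed directly in the context of the call; it has no variables
    -- that could be captured by the wrong lambda node.
    incBound-applyAbstraction o       e s []       bs = good⇒incBoundNode (ηApp (λ ()) e [])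
      (good-ηApp (λ ()) e s (AllVars-universal (λ ()) e) tt)
    incBound-applyAbstraction (A ⇒ B) e s (t ∷ ts) bs = incBound-abstraction (A ⇒ B) e s , bs

    mutual
      incBound-unfold : ∀ {Δ As} (t : Lam Δ As) → IncBound t → IncBound (unfold G t)
      incBound-unfold (ƛ u) b = incBound-unfoldNode u b

      incBound-unfoldNode : ∀ {Δ} (u : Node Δ) → IncBoundNode u → IncBoundNode (unfoldNode G u)
      incBound-unfoldNode (var x ts) (b , bs) = b , incBound-unfoldEach ts bs
      incBound-unfoldNode (ter f ts) bs       = incBound-unfoldEach ts bs
      incBound-unfoldNode (non F ts) bs       = incBound-applyAbstraction (nty F) (rule F) (safe F)
        (unfoldEach G ts) (incBound-unfoldEach ts bs)
      incBound-unfoldNode (app t ts) (b , bs) = incBound-unfold t b , incBound-unfoldEach ts bs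

      incBound-unfoldEach : ∀ {Δ As} (ts : Subs Δ As) → IncBoundAll ts → IncBoundAll (unfoldEach G ts)
      incBound-unfoldEach []       bs       = tt
      incBound-unfoldEach (t ∷ ts) (b , bs) = incBound-unfold t b , incBound-unfoldEach ts bs

    safe⇒incrementallyBound : IncrementallyBound G
    safe⇒incrementallyBound zero    = incBound-abstraction (nty start) (rule start) (safe start)
    safe⇒incrementallyBound (suc k) = incBound-unfold (nthUnfolding G k) (safe⇒incrementallyBound k)

  -- From incremental binding of all unfoldings to safe rules.

  unfolds : ℕ → ∀ {Δ As} → Lam Δ As → Lam Δ As
  unfolds zero    t = t
  unfolds (suc k) t = unfolds k (unfold G t)

  unfoldsNode : ℕ → ∀ {Δ} → Node Δ → Node Δ
  unfoldsNode zero    u = u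
  unfoldsNode (suc k) u = unfoldsNode k (unfoldNode G u)

  unfoldsEach : ℕ → ∀ {Δ As} → Subs Δ As → Subs Δ As
  unfoldsEach zero    ts = ts
  unfoldsEach (suc k) ts = unfoldsEach k (unfoldEach G ts)

  IncBoundNode∞ : ∀ {Δ} → Node Δ → Set
  IncBoundNode∞ u = ∀ k → IncBoundNode (unfoldsNode k u)

  IncBoundAll∞ : ∀ {Δ As} → Subs Δ As → Set
  IncBoundAll∞ ts = ∀ k → IncBoundAll (unfoldsEach k ts)

  -- `nthUnfolding` adds unfoldings on the outside, `unfolds` on the inside. The latter form lets
  -- recursion on `k` keep the root constructor visible in the lemmas that follow.
  unfold-unfolds : ∀ k {Δ As} (t : Lam Δ As) → unfold G (unfolds k t) ≡ unfolds k (unfold G t)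
  unfold-unfolds zero    t = refl
  unfold-unfolds (suc k) t = unfold-unfolds k (unfold G t)

  nthUnfolding-unfolds : ∀ k → nthUnfolding G k ≡ unfolds k (abstraction (rule start))
  nthUnfolding-unfolds zero    = refl
  nthUnfolding-unfolds (suc k) =
    trans (cong (unfold G) (nthUnfolding-unfolds k)) (unfold-unfolds k _)

  incBound-ƛ : ∀ k {Δ As} (u : Node (As ∷ Δ)) →
    IncBound (unfolds k (ƛ {As = As} u)) → IncBoundNode (unfoldsNode k u)
  incBound-ƛ zero    u b = b
  incBound-ƛ (suc k) u b = incBound-ƛ k (unfoldNode G u) b

  incBound-var : ∀ k {Δ A} (x : Var {Sg} Δ A) ts → IncBoundNode (unfoldsNode k (var x ts)) →
    Bound x × IncBoundAll (unfoldsEach k ts)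
  incBound-var zero    x ts b = b
  incBound-var (suc k) x ts b = incBound-var k x (unfoldEach G ts) b

  incBound-ter : ∀ k {Δ} f (ts : Subs Δ _) → IncBoundNode (unfoldsNode k (ter f ts)) →
    IncBoundAll (unfoldsEach k ts)
  incBound-ter zero    f ts b = b
  incBound-ter (suc k) f ts b = incBound-ter k f (unfoldEach G ts) b

  incBound-app : ∀ k {Δ A As} (t : Lam Δ (A ∷ As)) ts → IncBoundNode (unfoldsNode k (app t ts)) →
    IncBound (unfolds k t) × IncBoundAll (unfoldsEach k ts)
  incBound-app zero    t ts b = b
  incBound-app (suc k) t ts b = incBound-app k (unfold G t) (unfoldEach G ts) b

  incBound-∷ : ∀ k {Δ A As} (t : Lam Δ (args A)) (ts : Subs Δ As) →
    IncBoundAll (unfoldsEach k (All._∷_ {x = A} t ts)) →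
    IncBound (unfolds k t) × IncBoundAll (unfoldsEach k ts)
  incBound-∷ zero    t ts b = b
  incBound-∷ (suc k) t ts b = incBound-∷ k (unfold G t) (unfoldEach G ts) b

  incBound-[] : ∀ k {Δ} → IncBoundAll (unfoldsEach k {Δ} [])
  incBound-[] zero    = tt
  incBound-[] (suc k) = incBound-[] k

  -- Incremental binding constrains only rules reachable from the start symbol, so the evidence for
  -- a rule is one occurrence of its body. The choice of `ρ` covers bodies under their own lambda
  -- node and parameterless bodies placed directly in some context.
  Sound : ∀ {As} → Tm As o → Set
  Sound {As} e = ∃[ Δ ] Σ[ ρ ∈ (∀ {B} → B ∈ As → Var {Sg} Δ B) ] IncBoundNode∞ (ηApp ρ e [])

  incBound-applyAbs : ∀ {Δ As} (e : Tm As o) (ts : Subs Δ As) →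
    IncBoundNode∞ (applyAbstraction e ts) → Sound e × IncBoundAll∞ ts
  incBound-applyAbs e []       b = (_ , (λ ()) , b) , λ k → incBound-[] k
  incBound-applyAbs {Δ} e (t ∷ ts) b =
    (_ , here , λ k → incBound-ƛ k (ηApp here e [])
      (proj₁ (incBound-app k (abstraction {Δ = Δ} e) (t ∷ ts) (b k)))) ,
    λ k → proj₂ (incBound-app k (abstraction e) (t ∷ ts) (b k))

  SoundRule : Fin size → Set
  SoundRule F = Sound (rule F)

  -- A variable in an operand is bound outside the lambda node of the operand, so its order is at
  -- least that of the operand. At a call the soundness of the rule is only recorded, not explored,
  -- which keeps the recursion on the term.
  safe-ηApp : ∀ {Γ Δ A} (ρ : ∀ {B} → B ∈ Γ → Var {Sg} Δ B) (t : Tm Γ A) ts →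
    IncBoundNode∞ (ηApp ρ t ts) → IncBoundAll∞ ts × Safe SoundRule t × AllVars (Bound ∘ ρ) t
  safe-ηApp ρ (var x) ts b =
    (λ k → proj₂ (incBound-var k (ρ x) ts (b k))) , tt , proj₁ (incBound-var 0 (ρ x) ts (b 0))
  safe-ηApp ρ (ter f) ts b = (λ k → incBound-ter k f ts (b k)) , tt , tt
  -- From the first unfolding on, the call has become its body, and `b ∘ suc` speaks of that;
  -- `b zero` covers the operands before it.
  safe-ηApp ρ (non F) ts b with incBound-applyAbs (rule F) (unfoldEach G ts) (b ∘ suc)
  ... | s , bs = (λ { zero → b zero ; (suc k) → bs k }) , s , tt
  safe-ηApp ρ (_·_ {A} t r) ts b with safe-ηApp ρ t (ηLong ρ r ∷ ts) b
  ... | bs , s , v with safe-ηApp (there ∘ ρ) r (ηVars A here)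
                          (λ k → incBound-ƛ k _ (proj₁ (incBound-∷ k (ηLong ρ r) ts (bs k))))
  ... | _ , s′ , v′ = (λ k → proj₂ (incBound-∷ k (ηLong ρ r) ts (bs k))) ,
    (s , s′ , AllVars-map (λ x b → ≤-trans (≤-reflexive (sym (lamOrd-args A))) (≮⇒≥ (proj₁ b))) r v′) ,
    (v , AllVars-map (λ x → proj₂) r v′)

  -- The context of the occurrence serves only to extract safety, a property of the term;
  -- `good-body` then rebuilds the condition under the lambda node of the rule itself.
  soundRule⇒good : ∀ F → SoundRule F → GoodNode SoundRule (body F)
  soundRule⇒good F (_ , ρ , b) = good-body F (proj₁ (proj₂ (safe-ηApp ρ (rule F) [] b)))

  incrementallyBound⇒soundStart : IncrementallyBound G → SoundRule start
  incrementallyBound⇒soundStart b = _ , here ,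
    λ k → incBound-ƛ k _ (subst IncBound (nthUnfolding-unfolds k) (b k))

-- Higher-order stacks

module _ {Γ : Set} where

  Stk : ℕ → Set
  Stk N = Stack Γ (suc N)

  -- The number counts the enclosing `top`s: `popAt N d` is pop_(N + 1 - d),
  -- and pop_1 for every d ≥ N.
  popAt : ∀ N → ℕ → Op Γ (suc N)
  popAt zero    _       = pop
  popAt (suc N) zero    = pop
  popAt (suc N) (suc d) = top (popAt N d)

  -- Only meant for d < N.
  dupAt : ∀ N → ℕ → Op Γ (suc N)
  dupAt zero    _       = pop
  dupAt (suc N) zero    = dup
  dupAt (suc N) (suc d) = top (dupAt N d)

  pushAt : ∀ N → Γ → Op Γ (suc N)
  pushAt zero    a = push₁ a
  pushAt (suc N) a = top (pushAt N a)

  pushed : ∀ N → Γ → Stk N → Stk N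
  pushed zero    a s        = a ∷ s
  pushed (suc N) a (t ∷ ts) = pushed N a t ∷ ts

  apply-push : ∀ N a s → applyOp (pushAt N a) s ≡ just (pushed N a s)
  apply-push zero    a s        = refl
  apply-push (suc N) a (t ∷ ts) = cong (Maybe.map (_∷ ts)) (apply-push N a t)

  pop-push : ∀ N a s → applyOp (popAt N N) (pushed N a s) ≡ just s
  pop-push zero    a s        = refl
  pop-push (suc N) a (t ∷ ts) = cong (Maybe.map (_∷ ts)) (pop-push N a t)

  popAt-push : ∀ N {d} a s → d < N →
    applyOp (popAt N d) (pushed N a s) ≡ applyOp (popAt N d) s
  popAt-push (suc N) {zero}  a (t ∷ ts) d<N       = refl
  popAt-push (suc N) {suc d} a (t ∷ ts) (s≤s d<N) = cong (Maybe.map (_∷ ts)) (popAt-push N a t d<N)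

  dupd : ∀ N → ℕ → Stk N → Stk N
  dupd zero    _       s        = s
  dupd (suc N) zero    (t ∷ ts) = t ∷ t ∷ ts
  dupd (suc N) (suc d) (t ∷ ts) = dupd N d t ∷ ts

  apply-dup : ∀ N {d} s → d < N → applyOp (dupAt N d) s ≡ just (dupd N d s)
  apply-dup (suc N) {zero}  (t ∷ ts) d<N       = refl
  apply-dup (suc N) {suc d} (t ∷ ts) (s≤s d<N) = cong (Maybe.map (_∷ ts)) (apply-dup N t d<N)

  popAt-dup : ∀ N {d} s → d < N → applyOp (popAt N d) (dupd N d s) ≡ just s
  popAt-dup (suc N) {zero}  (t ∷ ts) d<N       = refl
  popAt-dup (suc N) {suc d} (t ∷ ts) (s≤s d<N) = cong (Maybe.map (_∷ ts)) (popAt-dup N t d<N)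

  -- A smaller depth pops a larger stack: the effect of `popAt N d` lies inside the top stack that
  -- `popAt N e` discards.
  popAt-popAt : ∀ N {d e} s {s′} → e < d → e < N → applyOp (popAt N d) s ≡ just s′ →
    applyOp (popAt N e) s′ ≡ applyOp (popAt N e) s
  popAt-popAt (suc N) {suc d} {zero}  (t ∷ ts) e<d e<N eq
    with applyOp (popAt N d) t | eq
  ... | just t′ | refl = refl
  popAt-popAt (suc N) {suc d} {suc e} (t ∷ ts) (s≤s e<d) (s≤s e<N) eq
    with applyOp (popAt N d) t in eq′ | eq
  ... | just t′ | refl = cong (Maybe.map (_∷ ts)) (popAt-popAt N t e<d e<N eq′)

  -- Agreement of the topmost stacks of order N + 1 - l, or 1 if l > N.
  SameTop : ∀ N → ℕ → Stk N → Stk N → Set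
  SameTop N       zero    s       s′       = s ≡ s′
  SameTop zero    (suc l) s       s′       = s ≡ s′
  SameTop (suc N) (suc l) (t ∷ _) (t′ ∷ _) = SameTop N l t t′

  SameTop-refl : ∀ N l {s} → SameTop N l s s
  SameTop-refl N       zero    = refl
  SameTop-refl zero    (suc l) = refl
  SameTop-refl (suc N) (suc l) = SameTop-refl N l

  SameTop-mono : ∀ N {l l′ s s′} → l ≤ l′ → SameTop N l s s′ → SameTop N l′ s s′
  SameTop-mono N       {l′ = l′} z≤n       refl = SameTop-refl N l′
  SameTop-mono zero    (s≤s l≤l′) eq = eq
  SameTop-mono (suc N) {s = _ ∷ _} {_ ∷ _} (s≤s l≤l′) eq = SameTop-mono N l≤l′ eq

  SameTop-dup : ∀ N {d} s → d < N → SameTop N (suc d) s (dupd N d s)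
  SameTop-dup (suc N) {zero}  (t ∷ ts) d<N       = refl
  SameTop-dup (suc N) {suc d} (t ∷ ts) (s≤s d<N) = SameTop-dup N t d<N

  -- A pop at depth at least `l` acts inside the shared top stack, so the other stack can follow.
  -- The minimum with `N` appears because from `N` on every depth means pop_1.
  SameTop-popAt : ∀ N {l d s s′ r} → l ⊓ N ≤ d → SameTop N l s s′ →
    applyOp (popAt N d) s ≡ just r → ∃[ r′ ] (applyOp (popAt N d) s′ ≡ just r′ × SameTop N l r r′)
  SameTop-popAt N       {zero}  l≤d refl eq = _ , eq , refl
  SameTop-popAt zero    {suc l} l≤d refl eq = _ , eq , refl
  SameTop-popAt (suc N) {suc l} {suc d} {t ∷ ts} {t′ ∷ ts′} (s≤s l≤d) same eq
    with applyOp (popAt N d) t in eq₁ | eq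
  ... | just u | refl with SameTop-popAt N {l} l≤d same eq₁
  ... | u′ , eq₂ , same′ = u′ ∷ ts′ , cong (Maybe.map (_∷ ts′)) eq₂ , same′

  module _ (bottom : Γ) where

    top-push : ∀ N a s → top₁ bottom (suc N) (pushed N a s) ≡ a
    top-push zero    a s        = refl
    top-push (suc N) a (t ∷ ts) = top-push N a t

    top-SameTop : ∀ N l {s s′} → SameTop N l s s′ → top₁ bottom (suc N) s ≡ top₁ bottom (suc N) s′
    top-SameTop N       zero    refl = refl
    top-SameTop zero    (suc l) refl = refl
    top-SameTop (suc N) (suc l) {_ ∷ _} {_ ∷ _} same = top-SameTop N l same

    top-emptyStack : ∀ N → top₁ bottom (suc N) (emptyStack bottom (suc N)) ≡ bottom
    top-emptyStack zero    = refl
    top-emptyStack (suc N) = top-emptyStack N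

-- From schemes to automata

-- The membership proof is what `codes-closed` takes to find a child among `codes` again.
nth : ∀ {A : Set} (xs : List A) → ℕ → Maybe (∃[ x ] x ∈ xs)
nth []       _       = nothing
nth (x ∷ xs) zero    = just (x , here refl)
nth (x ∷ xs) (suc j) = Maybe.map (λ (y , p) → y , there p) (nth xs j)

≤-sum : ∀ {A : Set} (f : A → ℕ) {x xs} → x ∈ xs → f x ≤ sum (List.map f xs)
≤-sum f (here refl) = m≤m+n _ _
≤-sum f (there p)   = ≤-trans (≤-sum f p) (m≤n+m _ _)

module FromScheme {Sg : RankedAlphabet} (G : Scheme Sg) (N : ℕ) where
  open RankedAlphabet Sg
  open Scheme G
  open TreeMachine G
  open Safety G

  Code : Set
  Code = ∃[ Δ ] Node Δ

  mutual
    nodes : ∀ {Δ} → Node Δ → List Code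
    nodes u@(var x ts) = (_ , u) ∷ nodesAll ts
    nodes u@(ter f ts) = (_ , u) ∷ nodesAll ts
    nodes u@(non F ts) = (_ , u) ∷ nodesAll ts
    nodes u@(app t ts) = (_ , u) ∷ nodesAll ts

    nodesAll : ∀ {Δ As} → Subs Δ As → List Code
    nodesAll []         = []
    nodesAll (ƛ u ∷ ts) = nodes u ++ nodesAll ts

  bodies : ∀ {Δ As} → Subs Δ As → List Code
  bodies []         = []
  bodies (ƛ u ∷ ts) = (_ , u) ∷ bodies ts

  children : Code → List Code
  children (_ , var x ts) = bodies ts
  children (_ , ter f ts) = bodies ts
  children (_ , non F ts) = bodies ts
  children (_ , app t ts) = bodies ts

  ∈-nodes : ∀ {Δ} (u : Node Δ) → (_ , u) ∈ nodes u
  ∈-nodes (var x ts) = here refl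
  ∈-nodes (ter f ts) = here refl
  ∈-nodes (non F ts) = here refl
  ∈-nodes (app t ts) = here refl

  bodies⊆nodesAll : ∀ {Δ As} (ts : Subs Δ As) {c} → c ∈ bodies ts → c ∈ nodesAll ts
  bodies⊆nodesAll (ƛ u ∷ ts) (here refl) = ∈-++⁺ˡ (∈-nodes u)
  bodies⊆nodesAll (ƛ u ∷ ts) (there p)   = ∈-++⁺ʳ (nodes u) (bodies⊆nodesAll ts p)

  mutual
    nodes-closed : ∀ {Δ} (u : Node Δ) {c d} → c ∈ nodes u → d ∈ children c → d ∈ nodes u
    nodes-closed (var x ts) (here refl) q = there (bodies⊆nodesAll ts q)
    nodes-closed (var x ts) (there p)   q = there (nodesAll-closed ts p q)
    nodes-closed (ter f ts) (here refl) q = there (bodies⊆nodesAll ts q)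
    nodes-closed (ter f ts) (there p)   q = there (nodesAll-closed ts p q)
    nodes-closed (non F ts) (here refl) q = there (bodies⊆nodesAll ts q)
    nodes-closed (non F ts) (there p)   q = there (nodesAll-closed ts p q)
    nodes-closed (app t ts) (here refl) q = there (bodies⊆nodesAll ts q)
    nodes-closed (app t ts) (there p)   q = there (nodesAll-closed ts p q)

    nodesAll-closed : ∀ {Δ As} (ts : Subs Δ As) {c d} →
      c ∈ nodesAll ts → d ∈ children c → d ∈ nodesAll ts
    nodesAll-closed (ƛ u ∷ ts) p q with ∈-++⁻ (nodes u) p
    ... | inj₁ p′ = ∈-++⁺ˡ (nodes-closed u p′ q)
    ... | inj₂ p′ = ∈-++⁺ʳ (nodes u) (nodesAll-closed ts p′ q)

  codes : List Code
  codes = concatMap (nodes ∘ body) (allFin size)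

  codes-closed : ∀ {c d} → c ∈ codes → d ∈ children c → d ∈ codes
  codes-closed p q = ∈-concatMap⁺ (nodes ∘ body)
    (Any.map (λ {F} p′ → nodes-closed (body F) p′ q) (∈-concatMap⁻ (nodes ∘ body) {xs = allFin size} p))

  body∈codes : ∀ F → (_ , body F) ∈ codes
  body∈codes F = ∈-concatMap⁺ (nodes ∘ body)
    (Any.map (λ { refl → ∈-nodes (body F) }) (∈-allFin F))

  K : ℕ
  K = length codes

  code : Fin K → Code
  code = lookup codes

  bodyIndex : Fin size → Fin K
  bodyIndex F = index (body∈codes F)

  code-bodyIndex : ∀ F → code (bodyIndex F) ≡ (_ , body F)
  code-bodyIndex F = sym (lookup-index (body∈codes F))

  childIndex : Fin K → ℕ → Maybe (Fin K)
  childIndex i j = Maybe.map (λ (_ , p) → index (codes-closed (∈-lookup i) p)) (nth (children (code i)) j)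

  childIndex-nth : ∀ i {j c p} → nth (children (code i)) j ≡ just (c , p) →
    ∃[ k ] (childIndex i j ≡ just k × code k ≡ c)
  childIndex-nth i {p = p} eq = _ , cong (Maybe.map _) eq , sym (lookup-index (codes-closed (∈-lookup i) p))

  depth : ∀ {Δ A} → Var {Sg} Δ A → ℕ
  depth (here _)  = 0
  depth (there x) = suc (depth x)

  position : ∀ {As} {A : Ty} → A ∈ As → ℕ
  position (here _)  = 0
  position (there x) = suc (position x)

  positionVar : ∀ {Δ A} → Var {Sg} Δ A → ℕ
  positionVar (here x)  = position x
  positionVar (there x) = positionVar x

  -- Bounds every counter that the node can write into a state; with `B` above all weights, `clamp`
  -- does not truncate them.
  weight : Code → ℕ
  weight (_ , var x ts) = suc (depth x) + positionVar x
  weight (_ , ter f ts) = arity f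
  weight (_ , non F ts) = 0
  weight (_ , app t ts) = 0

  B : ℕ
  B = sum (List.map weight codes)

  clamp : ℕ → Fin (suc B)
  clamp i = fromℕ< (s≤s (m⊓n≤n i B))

  toℕ-clamp : ∀ {i} → i ≤ B → toℕ (clamp i) ≡ i
  toℕ-clamp i≤B = trans (toℕ-fromℕ< _) (m≤n⇒m⊓n≡m i≤B)

  weight≤B : ∀ i → weight (code i) ≤ B
  weight≤B i = ≤-sum weight {xs = codes} (∈-lookup i)

  -- To look up a variable, `climb i j` pops to the i-th entry from the top,
  -- then to the caller of the lambda node of that entry, whose operand number
  -- j is entered by `descend j`.
  data State : Set where
    run     : State
    climb   : Fin (suc B) → Fin (suc B) → State
    descend : Fin (suc B) → State

  States : ℕ
  States = suc (suc (suc B) * suc B)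

  encode : State → Fin States
  encode run         = zero
  encode (descend j) = suc (combine {suc (suc B)} zero j)
  encode (climb i j) = suc (combine {suc (suc B)} (suc i) j)

  decodePair : Fin (suc (suc B)) × Fin (suc B) → State
  decodePair (zero  , j) = descend j
  decodePair (suc i , j) = climb i j

  decode : Fin States → State
  decode zero    = run
  decode (suc x) = decodePair (remQuot {suc (suc B)} (suc B) x)

  decode-encode : ∀ q → decode (encode q) ≡ q
  decode-encode run         = refl
  decode-encode (descend j) = cong decodePair (remQuot-combine {suc (suc B)} zero j)
  decode-encode (climb i j) = cong decodePair (remQuot-combine {suc (suc B)} (suc i) j)

  Sym : Set
  Sym = Fin (suc K)

  -- The rule body lies directly above its caller, an operand below the copy
  -- of the stack that was made when its variable was looked up.
  callerDepth : List (List Ty) → ℕ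
  callerDepth (As ∷ _ ∷ _) = lamOrd {Sg} As ∸ 1
  callerDepth _            = N

  Action : Set → Set
  Action Q = (Q × Op Sym (suc N)) ⊎ (∃[ f ] Vec Q (arity f))

  -- An operand of order 0 has no parameters, so nothing has to be copied; the
  -- symbol pushed in this case is removed by the extra step of `climb`.
  lookupAction : ∀ {Δ A} → Var {Sg} Δ A → ℕ → Action State
  lookupAction x zero    = inj₁ (climb (clamp (suc (depth x))) (clamp (positionVar x)) , pushAt N zero)
  lookupAction x (suc d) = inj₁ (climb (clamp (depth x)) (clamp (positionVar x)) , dupAt N d)

  junk : Action State
  junk = inj₁ (run , popAt N N)

  runAction : Code → Action State
  runAction (_ , var {A} x ts) = lookupAction x (ord A)
  runAction (_ , ter f ts)     = inj₂ (f , Vec.tabulate (λ i → descend (clamp (toℕ i))))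
  runAction (_ , non F ts)     = inj₁ (run , pushAt N (suc (bodyIndex F)))
  runAction (_ , app t ts)     = junk

  descendAction : Maybe (Fin K) → Action State
  descendAction (just k) = inj₁ (run , pushAt N (suc k))
  descendAction nothing  = junk

  action : State → Sym → Action State
  -- In state `run`, the symbol `zero` means the empty initial stack. As the extra symbol of
  -- `lookupAction` it is met only in state `climb`.
  action run             zero    = inj₁ (run , pushAt N (suc (bodyIndex start)))
  action run             (suc i) = runAction (code i)
  action (climb (suc i) j) _     = inj₁ (climb (inject₁ i) j , popAt N N)
  action (climb zero j)  zero    = junk
  action (climb zero j)  (suc i) = inj₁ (descend j , popAt N (callerDepth (proj₁ (code i))))
  action (descend j)     zero    = junk
  action (descend j)     (suc i) = descendAction (childIndex i (toℕ j))

  encodeAction : Action State → Action (Fin States)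
  encodeAction (inj₁ (q , φ))  = inj₁ (encode q , φ)
  encodeAction (inj₂ (f , qs)) = inj₂ (f , Vec.map encode qs)

  pda : PDA Sg (suc N)
  pda = record
    { stackSymbols = suc K
    ; bottom       = zero
    ; states       = States
    ; initial      = zero
    ; δ            = λ q a → encodeAction (action (decode q) a)
    }

nth-cong : ∀ {A : Set} {xs ys : List A} {j x p} → xs ≡ ys → nth ys j ≡ just (x , p) →
  ∃[ p′ ] nth xs j ≡ just (x , p′)
nth-cong refl eq = _ , eq

-- Correctness of the automaton built from a scheme.

module Simulation {Sg : RankedAlphabet} (G : Scheme Sg) (N : ℕ)
  (bounded : ∀ F → ord (Scheme.nty G F) ≤ suc N) where
  open RankedAlphabet Sg
  open Scheme G
  open TreeMachine G
  open Safety G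
  open FromScheme G N

  S : Set
  S = Stack Sym (suc N)

  topSym : S → Sym
  topSym = top₁ zero (suc N)

  Valid : Code → Set
  Valid (Δ , u) = GoodNode SoundRule u × All (λ As → lamOrd {Sg} As ≤ suc N) Δ

  -- The strict bound makes copying possible: for a variable of order `suc d` it gives `d < N`, so
  -- the stack of order `N - d` to be duplicated has order at least 1.
  ord-bound : ∀ {Δ A} (x : Var {Sg} Δ A) → Bound x → All (λ As → lamOrd {Sg} As ≤ suc N) Δ →
    ord A < suc N
  ord-bound (here x)  b       (k ∷ ks) = ≤-trans b k
  ord-bound (there x) (_ , b) (k ∷ ks) = ord-bound x b ks

  valid-bodies : ∀ {Δ As} (ts : Subs Δ As) → GoodAll SoundRule ts →
    (∀ {A} → A ∈ As → ord A ≤ suc N) → All (λ As → lamOrd {Sg} As ≤ suc N) Δ →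
    ∀ {d} → d ∈ bodies ts → Valid d
  valid-bodies (_∷_ {x = A} (ƛ u) ts) (g , gs) h ks (here refl) =
    g , ≤-trans (≤-reflexive (lamOrd-args A)) (h (here refl)) ∷ ks
  valid-bodies (ƛ u ∷ ts) (g , gs) h ks (there p) = valid-bodies ts gs (h ∘ there) ks p

  ord-groundTy : ∀ k → ord (groundTy k) ≤ 1
  ord-groundTy zero    = z≤n
  ord-groundTy (suc k) = ⊔-lub ≤-refl (ord-groundTy k)

  valid-child : ∀ {c d} → Valid c → d ∈ children c → Valid d
  valid-child {_ , var {A} x ts} ((b , gs) , ks) = valid-bodies ts gs
    (λ y → <⇒≤ (≤-trans (ord-arg A y) (<⇒≤ (ord-bound x b ks)))) ks
  valid-child {_ , ter f ts} (gs , ks) = valid-bodies ts gs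
    (λ y → ≤-trans (<⇒≤ (≤-trans (ord-arg (groundTy (arity f)) y) (ord-groundTy (arity f)))) (s≤s z≤n)) ks
  valid-child {_ , non F ts} ((_ , gs) , ks) = valid-bodies ts gs
    (λ y → ≤-trans (<⇒≤ (ord-arg (nty F) y)) (bounded F)) ks

  valid-body : ∀ {F} → SoundRule F → Valid (_ , body F)
  valid-body {F} h = soundRule⇒good F h ,
    (≤-trans (≤-reflexive (lamOrd-args (nty F))) (bounded F)) ∷ []

  IsNode : ∀ {Δ} → S → Node Δ → Set
  IsNode s u = ∃[ i ] (topSym s ≡ suc i × code i ≡ (_ , u))

  -- s represents the configuration (u , E) as far as variables of order at
  -- least l are concerned.  The binder of such a variable has order > l and,
  -- by incremental binding, all lambda nodes passed on the way to it have
  -- smaller order: hence the maximum in front of `Below`.  As moving to its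
  -- caller only touches the topmost stack of order n - l, the part of s below
  -- that stack is free to keep the configuration to which to return.
  mutual
    Rep : ℕ → S → ∀ {Δ} → Node Δ → Env Δ → Set
    Rep l s         u []                 = ⊥
    Rep l s {Δ} u (_∷_ {As} (frame ts E′) E) =
      IsNode s u × Valid (_ , u) ×
      (l < lamOrd {Sg} As → Caller l (callerDepth Δ) s ts E′) ×
      Below (l ⊔ lamOrd {Sg} As) s E

    Below : ℕ → S → ∀ {Δ} → Env Δ → Set
    Below l s []          = ⊤
    Below l s {Δ} (φ ∷ E) = Σ[ s′ ∈ S ] Σ[ u ∈ Node Δ ]
      (applyOp (popAt N N) s ≡ just s′ × Rep l s′ u (φ ∷ E))

    Caller : ℕ → ℕ → S → ∀ {Δ As} → Subs Δ As → Env Δ → Set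
    Caller l d s {Δ} ts E = Σ[ s′ ∈ S ] Σ[ v ∈ Node Δ ]
      (applyOp (popAt N d) s ≡ just s′ × children (_ , v) ≡ bodies ts × Rep l s′ v E)

  Rep-node : ∀ {l s Δ} {u : Node Δ} E → Rep l s u E → IsNode s u
  Rep-node (frame _ _ ∷ _) (n , _) = n

  RepConf : ℕ → S → Conf → Set
  RepConf l s (_ , u , E) = Rep l s u E

  Rep-mono : ∀ {l l′ s Δ} {u : Node Δ} E → l ≤ l′ → Rep l s u E → Rep l′ s u E
  Rep-mono (frame ts E′ ∷ E) l≤l′ (n , v , c , b) =
    n , v ,
    (λ lt → let s′ , w , eq , ch , r = c (≤-<-trans l≤l′ lt) in s′ , w , eq , ch , Rep-mono E′ l≤l′ r) ,
    below E b
    where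
    below : ∀ {Δ} (E : Env Δ) → Below _ _ E → Below _ _ E
    below []      _                  = tt
    below (φ ∷ E) (s′ , w , eq , r) = s′ , w , eq , Rep-mono (φ ∷ E) (⊔-monoˡ-≤ _ l≤l′) r

  callerDepth-≥ : ∀ {l As} Δ → l < lamOrd {Sg} As → l ⊓ N ≤ callerDepth (As ∷ Δ)
  callerDepth-≥ {l} []      lt = m⊓n≤n l N
  callerDepth-≥ {l} (_ ∷ _) lt = ≤-trans (m⊓n≤m l N) (∸-monoˡ-≤ 1 lt)

  mutual
    -- All pops that `Rep l` follows stay in the shared top stack: a binder of order above `l` has
    -- `callerDepth` at least `l` or equal to `N`, and moving to a parent node is pop_1. In
    -- particular a fresh copy represents the same configuration at level `l`.
    Rep-SameTop : ∀ {l s s′ Δ} {u : Node Δ} E → SameTop N l s s′ → Rep l s u E → Rep l s′ u E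
    Rep-SameTop {l} {Δ = As ∷ Δ} (frame ts E′ ∷ E) same ((i , eq , ci) , v , c , b) =
      (i , trans (sym (top-SameTop zero N l same)) eq , ci) , v ,
      (λ lt → Caller-SameTop E′ (callerDepth-≥ Δ lt) same (c lt)) ,
      Below-SameTop E (m≤m⊔n l (lamOrd {Sg} As)) same b

    Caller-SameTop : ∀ {l d s s′ Δ As} {ts : Subs Δ As} E → l ⊓ N ≤ d → SameTop N l s s′ →
      Caller l d s ts E → Caller l d s′ ts E
    Caller-SameTop {l} E l≤d same (r , w , eq , ch , rep) =
      let r′ , eq′ , same′ = SameTop-popAt N {l} l≤d same eq
      in r′ , w , eq′ , ch , Rep-SameTop E same′ rep

    Below-SameTop : ∀ {l k s s′ Δ} (E : Env Δ) → l ≤ k → SameTop N l s s′ → Below k s E → Below k s′ E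
    Below-SameTop         []      l≤k same _ = tt
    Below-SameTop {l} {k} (φ ∷ E) l≤k same (r , w , eq , rep) =
      let r′ , eq′ , same′ = SameTop-popAt N {l} (m⊓n≤n l N) same eq
      in r′ , w , eq′ , Rep-SameTop (φ ∷ E) (SameTop-mono N l≤k same′) rep

  infix 4 _↝_

  -- Runs are non-empty, so that undoing one strictly shrinks a derivation of `Outputs`. Recursion
  -- in `Outputs⇒TOut` relies on this.
  data _↝_ : State × S → State × S → Set where
    move : ∀ {q s q′ φ s′} → action q (topSym s) ≡ inj₁ (q′ , φ) → applyOp φ s ≡ just s′ →
           (q , s) ↝ (q′ , s′)
    _◅◅_ : ∀ {x y z} → x ↝ y → y ↝ z → x ↝ z

  δ-encode : ∀ q a → PDA.δ pda (encode q) a ≡ encodeAction (action q a)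
  δ-encode q a = cong (λ q → encodeAction (action q a)) (decode-encode q)

  outSize : ∀ {q s p f} → Outputs pda q s p f → ℕ
  outSize (move _ _ d)  = suc (outSize d)
  outSize (root _)      = 0
  outSize (child _ i d) = suc (outSize d)

  ↝-forward : ∀ {q s q′ s′ p f} → (q , s) ↝ (q′ , s′) →
    Outputs pda (encode q′) s′ p f → Outputs pda (encode q) s p f
  ↝-forward {q} {s} (move eq eq′) d =
    move (trans (δ-encode q (topSym s)) (cong encodeAction eq)) eq′ d
  ↝-forward (r ◅◅ r′) d = ↝-forward r (↝-forward r′ d)

  ↝-backward : ∀ {q s q′ s′ p f} → (q , s) ↝ (q′ , s′) → (d : Outputs pda (encode q) s p f) →
    Σ[ d′ ∈ Outputs pda (encode q′) s′ p f ] outSize d′ < outSize d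
  ↝-backward {q} {s} (move eq eq′) d
    with δeq ← trans (δ-encode q (topSym s)) (cong encodeAction eq) with d
  ... | move e e′ d′ with refl ← trans (sym e) δeq with refl ← trans (sym e′) eq′ = d′ , ≤-refl
  ... | root e with () ← trans (sym e) δeq
  ... | child e i d′ with () ← trans (sym e) δeq
  ↝-backward (r ◅◅ r′) d with ↝-backward r d
  ... | d′ , lt with ↝-backward r′ d′
  ... | d″ , lt′ = d″ , ≤-trans lt′ (<⇒≤ lt)

  ↝-backward-≡ : ∀ {q̂ q s q′ s′ p f} → q̂ ≡ encode q → (q , s) ↝ (q′ , s′) →
    (d : Outputs pda q̂ s p f) →
    Σ[ d′ ∈ Outputs pda (encode q′) s′ p f ] outSize d′ < outSize d
  ↝-backward-≡ refl = ↝-backward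

  -- By safety an operand of order `l` refers outwards only to variables of order at least `l`, so
  -- `Rep l` is enough at the node that owns it.
  data Found (l : ℕ) (s : S) (j : ℕ) {A : Ty} : Closure A → Set where
    found : ∀ {Δ As} {ts : Subs Δ As} {E : Env Δ} (x : A ∈ As) (v : Node Δ) → position x ≡ j →
            children (_ , v) ≡ bodies ts → Rep l s v E →
            Found l s j (closure (All.lookup ts x) E)

  climb-pop : ∀ {s s′ d j} (i : Fin (suc B)) → toℕ i ≡ suc d → applyOp (popAt N N) s ≡ just s′ →
    Σ[ i′ ∈ Fin (suc B) ] (toℕ i′ ≡ d × (climb i j , s) ↝ (climb i′ j , s′))
  climb-pop (suc i) refl eq = inject₁ i , toℕ-inject₁ i , move refl eq

  <-callerDepth : ∀ {e l As} Δ → e < l → e < N → l < lamOrd {Sg} As → e < callerDepth (As ∷ Δ)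
  <-callerDepth []      e<l e<N lt = e<N
  <-callerDepth (_ ∷ _) e<l e<N lt = ≤-trans e<l (∸-monoˡ-≤ 1 lt)

  -- The lambda nodes passed have order at most `ord A`, so the maximum in `Below` does not raise
  -- the level. Every pop on the way has depth at least `ord A` or equal to `N`, so pops of smaller
  -- depth still see the original stack, as the last component states.
  climb-correct : ∀ {s Δ A} {u : Node Δ} {E} (x : Var {Sg} Δ A) → Bound x → Rep (ord A) s u E →
    ∀ i → toℕ i ≡ depth x → ∀ j →
    Σ[ s′ ∈ S ] ((climb i j , s) ↝ (descend j , s′) ×
                 Found (ord A) s′ (positionVar x) (lookupVar E x) ×
                 (∀ {e} → e < ord A → e < N → applyOp (popAt N e) s′ ≡ applyOp (popAt N e) s))
  climb-correct {s} {As ∷ Δ} {E = frame ts E′ ∷ E} (here x) lt ((k , eq , ck) , v , c , b) zero refl j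
    with c lt
  ... | s′ , w , eq′ , ch , rep =
    s′ , move (trans (cong (action (climb zero j)) eq)
                     (cong (λ c → inj₁ (descend j , popAt N (callerDepth (proj₁ c)))) ck)) eq′ ,
    found x w refl ch rep ,
    λ e<l e<N → popAt-popAt N s (<-callerDepth Δ e<l e<N lt) e<N eq′
  climb-correct {s} {E = frame ts E′ ∷ (φ ∷ E)} (there x) (nlt , bd) (_ , _ , _ , (_ , _ , eq , rep)) i i≡ j
    with climb-pop {j = j} i i≡ eq
  ... | i′ , i′≡ , r
    with climb-correct x bd (Rep-mono (φ ∷ E) (⊔-lub ≤-refl (≮⇒≥ nlt)) rep) i′ i′≡ j
  ... | s′ , r′ , fnd , pops =
    s′ , r ◅◅ r′ , fnd , λ e<l e<N → trans (pops e<l e<N) (popAt-popAt N s e<N e<N eq)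

  nth-bodies : ∀ {Δ As A} (ts : Subs Δ As) (x : A ∈ As) →
    ∃[ p ] nth (bodies ts) (position x) ≡ just ((_ , lamBody (All.lookup ts x)) , p)
  nth-bodies (ƛ u ∷ ts) (here refl) = _ , refl
  nth-bodies (ƛ u ∷ ts) (there x) with nth-bodies ts x
  ... | p , eq = there p , cong (Maybe.map _) eq

  descend-correct : ∀ {l s k A c} j → Found l s k {A} c → toℕ j ≡ k → l ≤ lamOrd {Sg} (args A) →
    ∀ {Δ} (ts : Subs Δ (args A)) (E : Env Δ) →
    (0 < lamOrd {Sg} (args A) → ∀ a → Caller 0 (lamOrd {Sg} (args A) ∸ 1) (pushed N a s) ts E) →
    Σ[ s′ ∈ S ] ((descend j , s) ↝ (run , s′) × RepConf 0 s′ (enter c (frame ts E)))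
  descend-correct {s = s} j
    (found {ts = ts′} {E = φ@(frame _ _) ∷ E′} x v refl ch rep@((i , eq , ci) , val , _))
    j≡ l≤ ts E caller
    with nth-bodies ts′ x
  ... | p , nth≡ with nth-cong (trans (cong children ci) ch) (trans (cong (nth _) j≡) nth≡)
  ... | p′ , nth≡′ with childIndex-nth i nth≡′
  ... | k , ck≡ , code≡ =
    pushed N (suc k) s ,
    move (trans (cong (action (descend j)) eq) (cong descendAction ck≡)) (apply-push N (suc k) s) ,
    (k , top-push zero N (suc k) s , code≡) ,
    valid-child {_ , v} val (subst (_ ∈_) (sym ch) p) ,
    (λ lt → caller lt (suc k)) ,
    s , v , pop-push N (suc k) s , Rep-mono (φ ∷ E′) l≤ rep

  run-var : ∀ {s Δ A} {x : Var {Sg} Δ A} {ts : Subs Δ (args A)} {E} → Rep 0 s (var x ts) E →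
    Σ[ s′ ∈ S ] ((run , s) ↝ (run , s′) × RepConf 0 s′ (enter (lookupVar E x) (frame ts E)))
  run-var {s} {Δ} {A} {x} {ts} {φ@(frame _ _) ∷ E} rep@((k , eq , ck) , val@((bd , _) , ks) , _) =
    go (ord A) refl
    where
    w≤ : suc (depth x) + positionVar x ≤ B
    w≤ = subst (λ c → weight c ≤ B) ck (weight≤B k)

    toℕ-depth : toℕ (clamp (depth x)) ≡ depth x
    toℕ-depth = toℕ-clamp (≤-trans (m≤m+n _ _) (≤-trans (n≤1+n _) w≤))

    toℕ-suc-depth : toℕ (clamp (suc (depth x))) ≡ suc (depth x)
    toℕ-suc-depth = toℕ-clamp (≤-trans (m≤m+n _ _) w≤)

    j : Fin (suc B)
    j = clamp (positionVar x)

    toℕ-j : toℕ j ≡ positionVar x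
    toℕ-j = toℕ-clamp (≤-trans (m≤n+m _ _) w≤)

    action≡ : ∀ {l} → ord A ≡ l → action run (topSym s) ≡ lookupAction x l
    action≡ refl = trans (cong (action run) eq) (cong runAction ck)

    go : ∀ l → ord A ≡ l →
      Σ[ s′ ∈ S ] ((run , s) ↝ (run , s′) ×
                   RepConf 0 s′ (enter (lookupVar (φ ∷ E) x) (frame ts (φ ∷ E))))
    -- The dummy push and the first pop of `climb` cancel, so the climb proper starts from `s`.
    go zero l≡
      with climb-pop {j = j} (clamp (suc (depth x))) toℕ-suc-depth (pop-push N zero s)
    ... | i , i≡ , r
      with climb-correct x bd (Rep-mono (φ ∷ E) z≤n rep) i i≡ j
    ... | s₁ , r₁ , fnd , _
      with descend-correct j fnd toℕ-j (≤-reflexive (sym (lamOrd-args A))) ts (φ ∷ E)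
             (λ lt → contradiction (subst (0 <_) (trans (lamOrd-args A) l≡) lt) (n≮n 0))
    ... | s₂ , r₂ , rep₂ =
      s₂ , (move (action≡ l≡) (apply-push N zero s) ◅◅ r) ◅◅ (r₁ ◅◅ r₂) , rep₂
    -- The climb happens in the copy, at level `ord A`. Afterwards `popAt N d` drops the copy and
    -- returns to `s` itself, where the operands `ts` are represented at level 0.
    go (suc d) l≡
      with d<N ← ≤-pred (subst (_< suc N) l≡ (ord-bound x bd ks))
      with climb-correct x bd
             (subst (λ l → Rep l (dupd N d s) (var x ts) (φ ∷ E)) (sym l≡)
               (Rep-SameTop (φ ∷ E) (SameTop-dup N s d<N) (Rep-mono (φ ∷ E) z≤n rep)))
             (clamp (depth x)) toℕ-depth j
    ... | s₁ , r₁ , fnd , pops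
      with descend-correct j fnd toℕ-j (≤-reflexive (sym (lamOrd-args A))) ts (φ ∷ E)
             (λ lt a → s , var x ts ,
               trans (cong (λ l → applyOp (popAt N (l ∸ 1)) (pushed N a s₁)) (trans (lamOrd-args A) l≡))
               (trans (popAt-push N a s₁ d<N)
               (trans (pops (subst (d <_) (sym l≡) ≤-refl) d<N) (popAt-dup N s d<N))) ,
               refl , rep)
    ... | s₂ , r₂ , rep₂ =
      s₂ , move (action≡ l≡) (apply-dup N s d<N) ◅◅ (r₁ ◅◅ r₂) , rep₂

  run-non : ∀ {s Δ F} {ts : Subs Δ (args (nty F))} {E} → Rep 0 s (non F ts) E →
    Σ[ s′ ∈ S ] ((run , s) ↝ (run , s′) × Rep 0 s′ (body F) (frame ts E ∷ []))
  run-non {s} {F = F} {ts} {φ@(frame _ _) ∷ E} rep@((k , eq , ck) , ((sound , _) , _) , _) =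
    pushed N a s ,
    move (trans (cong (action run) eq) (cong runAction ck)) (apply-push N a s) ,
    (_ , top-push zero N a s , code-bodyIndex F) , valid-body sound ,
    (λ _ → s , non F ts , pop-push N a s , refl , rep) , tt
    where
    a : Sym
    a = suc (bodyIndex F)

  groundVar : ∀ k → Fin k → o ∈ args (groundTy k)
  groundVar (suc k) zero    = here refl
  groundVar (suc k) (suc i) = there (groundVar k i)

  lookup-groundVar : ∀ {P : Ty → Set} k (ts : All P (args (groundTy k))) i →
    All.lookup ts (groundVar k i) ≡ groundArg k ts i
  lookup-groundVar (suc k) (t ∷ ts) zero    = refl
  lookup-groundVar (suc k) (t ∷ ts) (suc i) = lookup-groundVar k ts i

  position-groundVar : ∀ k i → position (groundVar k i) ≡ toℕ i
  position-groundVar (suc k) zero    = refl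
  position-groundVar (suc k) (suc i) = cong suc (position-groundVar k i)

  childState : ∀ {f} → Fin (arity f) → State
  childState i = descend (clamp (toℕ i))

  run-ter : ∀ {s Δ f} {ts : Subs Δ (args (groundTy (arity f)))} {E} → Rep 0 s (ter f ts) E →
    action run (topSym s) ≡ inj₂ (f , Vec.tabulate (childState {f}))
  run-ter {E = E} rep with Rep-node E rep
  ... | k , eq , ck = trans (cong (action run) eq) (cong runAction ck)

  run-child : ∀ {s Δ f} {ts : Subs Δ (args (groundTy (arity f)))} {E} → Rep 0 s (ter f ts) E → ∀ i →
    Σ[ s′ ∈ S ] ((childState {f} i , s) ↝ (run , s′) ×
      RepConf 0 s′ (enter {o} (closure (groundArg (arity f) ts i) E) (frame [] E)))
  run-child {s} {f = f} {ts} {E} rep i with Rep-node E rep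
  ... | k , eq , ck = descend-correct (clamp (toℕ i))
      (subst (λ t → Found 0 s (toℕ i) (closure t E)) (lookup-groundVar (arity f) ts i)
        (found (groundVar (arity f) i) (ter f ts) (position-groundVar (arity f) i) refl rep))
      (toℕ-clamp (≤-trans (<⇒≤ (toℕ<n i)) (subst (λ c → weight c ≤ B) ck (weight≤B k))))
      z≤n [] E (λ ())

  lookup-childStates : ∀ {f} (i : Fin (arity f)) →
    Vec.lookup (Vec.map encode (Vec.tabulate (childState {f}))) i ≡ encode (childState {f} i)
  lookup-childStates {f} i =
    trans (lookup-map i encode (Vec.tabulate (childState {f}))) (cong encode (lookup∘tabulate (childState {f}) i))

  TOut⇒Outputs : ∀ {m c s p f} → TOut m c p f → RepConf 0 s c → Outputs pda (encode run) s p f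
  TOut⇒Outputs (var d) rep with run-var rep
  ... | s′ , r , rep′ = ↝-forward r (TOut⇒Outputs d rep′)
  TOut⇒Outputs (non d) rep with run-non rep
  ... | s′ , r , rep′ = ↝-forward r (TOut⇒Outputs d rep′)
  TOut⇒Outputs root rep = root (cong encodeAction (run-ter rep))
  TOut⇒Outputs {s = s} {p = _ ∷ p} {g} (child {f = f} i d) rep with run-child rep i
  ... | s′ , r , rep′ = child (cong encodeAction (run-ter rep)) i
    (subst (λ q → Outputs pda q s p g) (sym (lookup-childStates {f} i))
      (↝-forward r (TOut⇒Outputs d rep′)))

  Outputs⇒TOut : ∀ {K s Δ} (u : Node Δ) {E p f} (d : Outputs pda (encode run) s p f) → outSize d < K →
    Rep 0 s u E → ∃[ m ] TOut m (_ , u , E) p f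
  Outputs⇒TOut {suc K} (var x ts) d d<K rep with run-var rep
  ... | s′ , r , rep′ with ↝-backward r d
  ... | d′ , lt with Outputs⇒TOut _ d′ (≤-trans lt (≤-pred d<K)) rep′
  ... | m , t = m , var t
  Outputs⇒TOut {suc K} (non F ts) d d<K rep with run-non rep
  ... | s′ , r , rep′ with ↝-backward r d
  ... | d′ , lt with Outputs⇒TOut _ d′ (≤-trans lt (≤-pred d<K)) rep′
  ... | m , t = suc m , non t
  Outputs⇒TOut {suc K} (app t ts) {frame _ _ ∷ _} d d<K (_ , (() , _) , _)
  Outputs⇒TOut {suc K} {s} (ter f ts) d d<K rep with d
  ... | move e _ _ with () ← trans (sym e) (cong encodeAction (run-ter rep))
  ... | root e with refl ← trans (sym e) (cong encodeAction (run-ter rep)) = 0 , root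
  ... | child {p = p} {g} e i d′ with refl ← trans (sym e) (cong encodeAction (run-ter rep))
    with run-child rep i
  ... | s′ , r , rep′
    with ↝-backward-≡ (lookup-childStates {f} i) r d′
  ... | d″ , lt with Outputs⇒TOut _ d″ (≤-trans lt (<⇒≤ (≤-pred d<K))) rep′
  ... | m , t = m , child i t

  empty : S
  empty = emptyStack zero (suc N)

  startStack : S
  startStack = pushed N (suc (bodyIndex start)) empty

  start-↝ : (run , empty) ↝ (run , startStack)
  start-↝ = move (cong (action run) (top-emptyStack zero N)) (apply-push N _ empty)

  Rep-start : SoundRule start → RepConf 0 startStack startConf
  Rep-start h = (_ , top-push zero N _ empty , code-bodyIndex start) , valid-body h ,
    (λ lt → contradiction (subst (0 <_) (trans (lamOrd-args (nty start)) (cong ord start-ty)) lt) (n≮n 0)) ,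
    tt

  module _ (inc : IncrementallyBound G) where

    TOut⇔Outputs : ∀ {p f} → (∃[ m ] TOut m startConf p f) ⇔ Outputs pda zero empty p f
    TOut⇔Outputs = mk⇔
      (λ (m , d) → ↝-forward start-↝ (TOut⇒Outputs d rep))
      (λ d → let d′ , _ = ↝-backward start-↝ d in Outputs⇒TOut (body start) d′ ≤-refl rep)
      where
      rep : RepConf 0 startStack startConf
      rep = Rep-start (incrementallyBound⇒soundStart inc)

    pda-accepts : ∀ {t} → Generates G t → Accepts pda t
    pda-accepts gen p f =
      ⇔-trans (gen p f) (⇔-trans (HeadReduction.Produces⇔Out G) (⇔-trans (⇔-sym TOut⇔Out) TOut⇔Outputs))

-- From automata to schemes

fun : ℕ → Ty → Ty → Ty
fun zero    A B = B
fun (suc k) A B = A ⇒ fun k A B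

-- The element of `Fin k` rules out an empty block, which would not raise the order; the initial
-- state provides it.
ord-fun : ∀ {k} → Fin k → ∀ A → ord (fun k A A) ≡ suc (ord A)
ord-fun {suc zero}    zero A = m≥n⇒m⊔n≡m (n≤1+n (ord A))
ord-fun {suc (suc k)} _    A =
  trans (cong (suc (ord A) ⊔_) (ord-fun {suc k} zero A)) (⊔-idem (suc (ord A)))

infixl 6 _⊕_

-- Accumulating addition: `d ⊕ suc k` reduces to `suc d ⊕ k`, so passing from a stack to its top
-- component changes no type and calls for no transport. `shift` follows the same pattern.
_⊕_ : ℕ → ℕ → ℕ
d ⊕ zero  = d
d ⊕ suc k = suc d ⊕ k

⊕-suc : ∀ d k → suc d ⊕ k ≡ suc (d ⊕ k)
⊕-suc d zero    = refl
⊕-suc d (suc k) = ⊕-suc (suc d) k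

0⊕ : ∀ n → 0 ⊕ n ≡ n
0⊕ zero    = refl
0⊕ (suc n) = trans (⊕-suc 0 n) (cong suc (0⊕ n))

≤-⊕ : ∀ d k → d ≤ d ⊕ k
≤-⊕ d zero    = ≤-refl
≤-⊕ d (suc k) = ≤-trans (n≤1+n d) (≤-⊕ (suc d) k)

shift : ∀ {k} → ℕ → Fin k → ℕ
shift d zero    = d
shift d (suc i) = shift (suc d) i

shift≤⊕ : ∀ {k} d (i : Fin k) → shift d i ≤ d ⊕ k
shift≤⊕ {suc k} d zero    = ≤-⊕ d (suc k)
shift≤⊕ {suc k} d (suc i) = shift≤⊕ (suc d) i

blockVar : ∀ k {A B} → Fin k → A ∈ args (fun k A B)
blockVar (suc k) zero    = here refl
blockVar (suc k) (suc r) = there (blockVar k r)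

restVar : ∀ k {A B C} → C ∈ args B → C ∈ args (fun k A B)
restVar zero    x = x
restVar (suc k) x = there (restVar k x)

module _ {P : Ty → Set} where

  consBlock : ∀ k {A B} → (Fin k → P A) → All P (args B) → All P (args (fun k A B))
  consBlock zero    Ψ ts = ts
  consBlock (suc k) Ψ ts = Ψ zero ∷ consBlock k (Ψ ∘ suc) ts

  lookup-blockVar : ∀ k {A B} (Ψ : Fin k → P A) (ts : All P (args B)) r →
    All.lookup (consBlock k {A} {B} Ψ ts) (blockVar k r) ≡ Ψ r
  lookup-blockVar (suc k) Ψ ts zero    = refl
  lookup-blockVar (suc k) Ψ ts (suc r) = lookup-blockVar k (Ψ ∘ suc) ts r

  lookup-restVar : ∀ k {A B C} (Ψ : Fin k → P A) (ts : All P (args B)) (x : C ∈ args B) →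
    All.lookup (consBlock k {A} {B} Ψ ts) (restVar k x) ≡ All.lookup ts x
  lookup-restVar zero    Ψ ts x = refl
  lookup-restVar (suc k) Ψ ts x = lookup-restVar k (Ψ ∘ suc) ts x

  groundArgs : ∀ k → (Fin k → P o) → All P (args (groundTy k))
  groundArgs zero    h = []
  groundArgs (suc k) h = h zero ∷ groundArgs k (h ∘ suc)

  groundArg-groundArgs : ∀ k h i → groundArg k (groundArgs k h) i ≡ h i
  groundArg-groundArgs (suc k) h zero    = refl
  groundArg-groundArgs (suc k) h (suc i) = groundArg-groundArgs k (h ∘ suc) i

module FromPDA {Sg : RankedAlphabet} (N : ℕ) (P : PDA Sg (suc N)) where
  open RankedAlphabet Sg
  open PDA P

  n : ℕ
  n = suc N

  -- The type of the term for a state and a stack of order n - d: its arguments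
  -- are, for every state, the terms of the stacks uncovered by popping.
  σ : ℕ → Ty
  σ zero    = o
  σ (suc d) = fun states (σ d) (σ d)

  ord-σ : ∀ d → ord (σ d) ≡ d
  ord-σ zero    = refl
  ord-σ (suc d) = trans (ord-fun initial (σ d)) (cong suc (ord-σ d))

  -- `dead` is an everywhere undefined term, one for each type from `σ 0` to `σ N`, standing for
  -- what a failing pop uncovers.
  data NonTerminal : Set where
    start : NonTerminal
    dead  : Fin n → NonTerminal
    conf  : Fin states → Fin stackSymbols → NonTerminal

  ntTy : NonTerminal → Ty
  ntTy start      = o
  ntTy (dead i)   = σ (shift 0 i)
  ntTy (conf q a) = σ (0 ⊕ n)

  encode : NonTerminal → Fin (suc (n + states * stackSymbols))
  encode start      = zero
  encode (dead i)   = suc (i ↑ˡ (states * stackSymbols))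
  encode (conf q a) = suc (n ↑ʳ combine q a)

  decodeConf : Fin states × Fin stackSymbols → NonTerminal
  decodeConf (q , a) = conf q a

  decodeSum : Fin n ⊎ Fin (states * stackSymbols) → NonTerminal
  decodeSum = [ dead , decodeConf ∘ remQuot stackSymbols ]′

  decode : Fin (suc (n + states * stackSymbols)) → NonTerminal
  decode zero    = start
  decode (suc x) = decodeSum (splitAt n x)

  decode-encode : ∀ x → decode (encode x) ≡ x
  decode-encode start      = refl
  decode-encode (dead i)   = cong decodeSum (splitAt-↑ˡ n i (states * stackSymbols))
  decode-encode (conf q a) =
    trans (cong decodeSum (splitAt-↑ʳ n (states * stackSymbols) (combine q a)))
          (cong decodeConf (remQuot-combine q a))

  T : List Ty → Ty → Set
  T = Term Sg (ntTy ∘ decode)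

  non-as : ∀ {Γ} F {x} → decode F ≡ x → T Γ (ntTy x)
  non-as F refl = non F

  nt : ∀ {Γ} x → T Γ (ntTy x)
  nt x = non-as (encode x) (decode-encode x)

  applyBlock : ∀ {Γ} k {A B} → T Γ (fun k A B) → (Fin k → T Γ A) → T Γ B
  applyBlock zero    t Ψ = t
  applyBlock (suc k) t Ψ = applyBlock k (t · Ψ zero) (Ψ ∘ suc)

  applyGround : ∀ {Γ} k → T Γ (groundTy k) → (Fin k → T Γ o) → T Γ o
  applyGround zero    t h = t
  applyGround (suc k) t h = applyGround k (t · h zero) (h ∘ suc)

  -- For a stack of order k and each j ≤ k, the terms of the stack that pop_j
  -- uncovers in its top order-j stack, one for each state.
  Blocks : List Ty → ℕ → ℕ → Set
  Blocks Γ zero    d = ⊤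
  Blocks Γ (suc k) d = Blocks Γ k (suc d) × (Fin states → T Γ (σ d))

  fill : ∀ {Γ} k d → (Fin states → T Γ (σ (d ⊕ k))) → Blocks Γ k d → Fin states → T Γ (σ d)
  fill zero    d h bs       q = h q
  fill (suc k) d h (bs , Ψ) q = applyBlock states (fill k (suc d) h bs q) Ψ

  Heads : List Ty → ℕ → Set
  Heads Γ e = Fin states → Fin stackSymbols → T Γ (σ e)

  -- Symbolic execution: a pop selects a block; after a push, popping uncovers the old top `a` over
  -- the old block; after a duplication, it uncovers the term of the original stack.
  opTerm : ∀ {Γ k} → Op (Fin stackSymbols) k → ∀ d → Heads Γ (d ⊕ k) → Fin stackSymbols →
           Blocks Γ k d → Fin states → T Γ (σ d)
  opTerm (push₁ b) d h a (bs , Ψ) q = applyBlock states (h q b) (λ r → applyBlock states (h r a) Ψ)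
  opTerm pop       d h a (bs , Ψ) q = Ψ q
  opTerm dup       d h a (bs , Ψ) q = applyBlock states (fill _ (suc d) (λ r → h r a) bs q)
                                        (fill _ d (λ r → h r a) (bs , Ψ))
  opTerm (top φ)   d h a (bs , Ψ) q = applyBlock states (opTerm φ (suc d) h a bs q) Ψ

  embed : ∀ k d {A} → A ∈ args (σ d) → A ∈ args (σ (d ⊕ k))
  embed zero    d x = x
  embed (suc k) d x = embed k (suc d) (restVar states x)

  varBlocks : ∀ k d → Blocks (args (σ (d ⊕ k))) k d
  varBlocks zero    d = tt
  varBlocks (suc k) d = varBlocks k (suc d) , λ r → var (embed k (suc d) (blockVar states r))

  DeadTerms : ℕ → ℕ → Set
  DeadTerms k d = ∀ (i : Fin k) → T [] (σ (shift d i))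

  mutual
    stackTerm : ∀ k d → Heads [] (d ⊕ k) → DeadTerms k d →
                Stack (Fin stackSymbols) k → Fin states → T [] (σ d)
    stackTerm k d h om s = fill k d (λ q → h q (top₁ bottom k s)) (blocks k d h om s)

    blocks : ∀ k d → Heads [] (d ⊕ k) → DeadTerms k d → Stack (Fin stackSymbols) k → Blocks [] k d
    blocks zero          d h om s        = tt
    blocks (suc zero)    d h om []       = tt , λ _ → om zero
    blocks (suc zero)    d h om (a ∷ s)  =
      tt , λ r → applyBlock states (h r (top₁ bottom 1 s)) (proj₂ (blocks 1 d h om s))
    blocks (suc (suc k)) d h om (t ∷ ts) = blocks (suc k) (suc d) h (om ∘ suc) t , restTerm k d h om ts

    -- This is `stackTerm` of the remaining stack, written out so that the recursion is structural.
    -- An empty remainder is not a stack of order at least 2, hence the dead term.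
    restTerm : ∀ k d → Heads [] (d ⊕ suc (suc k)) → DeadTerms (suc (suc k)) d →
               List (Stack (Fin stackSymbols) (suc k)) → Fin states → T [] (σ d)
    restTerm k d h om []       r = om zero
    restTerm k d h om (t ∷ ts) r =
      applyBlock states (fill (suc k) (suc d) (λ q → h q (top₁ bottom (suc k) t))
                              (blocks (suc k) (suc d) h (om ∘ suc) t) r)
                        (restTerm k d h om ts)

  confHeads : ∀ {Γ} → Heads Γ (0 ⊕ n)
  confHeads q a = nt (conf q a)

  confTerm : Fin states → Stack (Fin stackSymbols) n → T [] o
  confTerm q s = stackTerm n 0 confHeads (λ i → nt (dead i)) s q

  confRule : Fin stackSymbols → (Fin states × Op (Fin stackSymbols) n) ⊎ (∃[ f ] Vec (Fin states) (arity f)) →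
             T (args (σ (0 ⊕ n))) o
  confRule a (inj₁ (q , φ))  = opTerm φ 0 confHeads a (varBlocks n 0) q
  confRule a (inj₂ (f , qs)) = applyGround (arity f) (ter f)
    (λ i → fill n 0 (λ r → confHeads r a) (varBlocks n 0) (Vec.lookup qs i))

  ruleFor : ∀ x → T (args (ntTy x)) o
  ruleFor start      = confTerm initial (emptyStack bottom n)
  ruleFor (dead i)   = nt (dead zero)
  ruleFor (conf q a) = confRule a (δ q a)

  scheme : Scheme Sg
  scheme = record
    { size     = suc (n + states * stackSymbols)
    ; nty      = ntTy ∘ decode
    ; rule     = ruleFor ∘ decode
    ; start    = zero
    ; start-ty = refl
    }

  open HeadReduction scheme
  open Safety scheme using (Safe; Vars≥; AllVars; AllVars-map; AllVars-universal; safe⇒incrementallyBound)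

  -- Runs of the automaton as head reduction of its scheme.

  Args : List Ty → Set
  Args Γ = All (T []) Γ

  SubstBlocks : ∀ {Γ} → Args Γ → ∀ k d → Blocks Γ k d → Blocks [] k d → Set
  SubstBlocks τ zero    d _        _          = ⊤
  SubstBlocks τ (suc k) d (bs , Ψ) (bs′ , Ψ′) = SubstBlocks τ k (suc d) bs bs′ × (∀ r → Ψ r [ τ ] ≡ Ψ′ r)

  module _ {Γ} {τ : Args Γ} where

    applyBlock-subst : ∀ k {A B} {t : T Γ (fun k A B)} {t′ Ψ Ψ′} → t [ τ ] ≡ t′ →
      (∀ r → Ψ r [ τ ] ≡ Ψ′ r) → applyBlock k {A} {B} t Ψ [ τ ] ≡ applyBlock k t′ Ψ′
    applyBlock-subst zero    eq eqs = eq
    applyBlock-subst (suc k) eq eqs = applyBlock-subst k (cong₂ _·_ eq (eqs zero)) (eqs ∘ suc)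

    fill-subst : ∀ k d {h h′} → (∀ q → h q [ τ ] ≡ h′ q) → ∀ bs bs′ → SubstBlocks τ k d bs bs′ →
      ∀ q → fill k d h bs q [ τ ] ≡ fill k d h′ bs′ q
    fill-subst zero    d eq _        _          _         q = eq q
    fill-subst (suc k) d eq (bs , Ψ) (bs′ , Ψ′) (es , e) q =
      applyBlock-subst states (fill-subst k (suc d) eq bs bs′ es q) e

    -- The instantiated rule is syntactically the term of the next stack, both being built from the
    -- same blocks. One unfolding is thus exactly one move of the automaton.
    opTerm-subst : ∀ {k} (φ : Op (Fin stackSymbols) k) d {h h′} om → (∀ q a → h q a [ τ ] ≡ h′ q a) →
      ∀ s {s′} bs → SubstBlocks τ k d bs (blocks k d h′ om s) → applyOp φ s ≡ just s′ →
      ∀ q → opTerm φ d h (top₁ bottom k s) bs q [ τ ] ≡ stackTerm k d h′ om s′ q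
    opTerm-subst (push₁ b) d om eq s bs (_ , e) refl q =
      applyBlock-subst states (eq q b) (λ r → applyBlock-subst states (eq r _) e)
    opTerm-subst (pop {zero})  d om eq (a ∷ s)       bs (_ , e) refl q = e q
    opTerm-subst (pop {suc k}) d om eq (t ∷ t′ ∷ ts) bs (_ , e) refl q = e q
    opTerm-subst (dup {k}) d om eq (t ∷ ts) (bs , Ψ) (es , e) refl q =
      applyBlock-subst states (fill-subst (suc k) (suc d) (λ r → eq r _) bs _ es q)
        (λ r → applyBlock-subst states (fill-subst (suc k) (suc d) (λ r → eq r _) bs _ es r) e)
    opTerm-subst (top φ) d om eq (t ∷ ts) (bs , Ψ) (es , e) eq′ q with applyOp φ t in eqφ | eq′
    ... | just t′ | refl = applyBlock-subst states (opTerm-subst φ (suc d) (om ∘ suc) eq t bs es eqφ q) e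

  Dead : ∀ {A} → T [] A → Set
  Dead t = ∀ {m ts p f} → ¬ Out m t ts p f

  applyBlock-dead : ∀ {Γ} {τ : Args Γ} k {A B} {t : T Γ (fun k A B)} {Ψ} →
    Dead (t [ τ ]) → Dead (applyBlock k {A} {B} t Ψ [ τ ])
  applyBlock-dead zero    dead-t = dead-t
  applyBlock-dead (suc k) dead-t = applyBlock-dead k (λ { (app d) → dead-t d })

  -- Only a pop can fail, possibly under some `top`s. The block it selects is dead, and it stays at
  -- the head of the applications added for the enclosing stacks.
  opTerm-dead : ∀ {Γ} {τ : Args Γ} {k} (φ : Op (Fin stackSymbols) k) d {h h′} om → (∀ i → Dead (om i)) →
    ∀ s bs → SubstBlocks τ k d bs (blocks k d h′ om s) → applyOp φ s ≡ nothing →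
    ∀ q → Dead (opTerm φ d h (top₁ bottom k s) bs q [ τ ])
  opTerm-dead (pop {zero})  d om dead-om []       bs (_ , e) _ q = subst Dead (sym (e q)) (dead-om zero)
  opTerm-dead (pop {suc k}) d om dead-om (t ∷ []) bs (_ , e) _ q = subst Dead (sym (e q)) (dead-om zero)
  opTerm-dead (top φ) d om dead-om (t ∷ ts) (bs , Ψ) (es , e) eq q with applyOp φ t in eqφ | eq
  ... | nothing | _ = applyBlock-dead states (opTerm-dead φ (suc d) (om ∘ suc) (dead-om ∘ suc) t bs es eqφ q)

  flatten : ∀ k d → Blocks [] k d → Args (args (σ d)) → Args (args (σ (d ⊕ k)))
  flatten zero    d bs       ts = ts
  flatten (suc k) d (bs , Ψ) ts = flatten k (suc d) bs (consBlock states {σ d} {σ d} Ψ ts)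

  lookup-embed : ∀ k d bs ts {A} (x : A ∈ args (σ d)) →
    All.lookup (flatten k d bs ts) (embed k d x) ≡ All.lookup ts x
  lookup-embed zero    d bs       ts x = refl
  lookup-embed (suc k) d (bs , Ψ) ts x =
    trans (lookup-embed k (suc d) bs _ (restVar states x)) (lookup-restVar states {σ d} {σ d} Ψ ts x)

  varBlocks-subst : ∀ k d bs ts → SubstBlocks (flatten k d bs ts) k d (varBlocks k d) bs
  varBlocks-subst zero    d bs       ts = tt
  varBlocks-subst (suc k) d (bs , Ψ) ts = varBlocks-subst k (suc d) bs _ ,
    λ r → trans (lookup-embed k (suc d) bs _ (blockVar states r)) (lookup-blockVar states {σ d} {σ d} Ψ ts r)

  Out-applyBlock : ∀ k {A B m} {t : T [] (fun k A B)} {Ψ ts p f} →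
    Out m t (consBlock k {A} {B} Ψ ts) p f ⇔ Out m (applyBlock k {A} {B} t Ψ) ts p f
  Out-applyBlock zero    = mk⇔ (λ d → d) (λ d → d)
  Out-applyBlock (suc k) {A} {B} = ⇔-trans (mk⇔ app (λ { (app d) → d })) (Out-applyBlock k {A} {B})

  Out-fill : ∀ k d {h bs q m ts p f} →
    Out m (h q) (flatten k d bs ts) p f ⇔ Out m (fill k d h bs q) ts p f
  Out-fill zero    d = mk⇔ (λ d → d) (λ d → d)
  Out-fill (suc k) d = ⇔-trans (Out-fill k (suc d)) (Out-applyBlock states {σ d} {σ d})

  Out-applyGround : ∀ {Γ} {τ : Args Γ} k {m} {t : T Γ (groundTy k)} {h p f} →
    Out m (t [ τ ]) (groundArgs k (λ i → h i [ τ ])) p f ⇔ Out m (applyGround k t h [ τ ]) [] p f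
  Out-applyGround zero    = mk⇔ (λ d → d) (λ d → d)
  Out-applyGround (suc k) = ⇔-trans (mk⇔ app (λ { (app d) → d })) (Out-applyGround k)

  Out-non-as : ∀ F {x} (eq : decode F ≡ x) {m ts p f} →
    Out m (ruleFor x [ ts ]) [] p f → Out (suc m) (non-as F eq) ts p f
  Out-non-as F refl = non

  Out-non-as⁻¹ : ∀ F {x} (eq : decode F ≡ x) {m ts p f} →
    Out m (non-as F eq) ts p f → ∃[ m′ ] (m ≡ suc m′ × Out m′ (ruleFor x [ ts ]) [] p f)
  Out-non-as⁻¹ F refl (non d) = _ , refl , d

  non-as-subst : ∀ {Γ} (τ : Args Γ) F {x} (eq : decode F ≡ x) → non-as F eq [ τ ] ≡ non-as F eq
  non-as-subst τ F refl = refl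

  nt-subst : ∀ {Γ} (τ : Args Γ) x → nt x [ τ ] ≡ nt x
  nt-subst τ x = non-as-subst τ (encode x) (decode-encode x)

  -- Every unfolding leads to `dead zero` again, so the finite index runs out.
  dead-nt : ∀ i → Dead (nt (dead i))
  dead-nt i {m} {ts} d with Out-non-as⁻¹ (encode (dead i)) (decode-encode (dead i)) {ts = ts} d
  dead-nt i {suc m} {ts} {p} {f} d | _ , refl , d′ =
    dead-nt zero {m} {[]} {p} {f} (subst (λ t → Out m t [] p f) (nt-subst ts (dead zero)) d′)

  confArgs : Stack (Fin stackSymbols) n → Args (args (σ (0 ⊕ n)))
  confArgs s = flatten n 0 (blocks n 0 confHeads (λ i → nt (dead i)) s) []

  confArgs-subst : ∀ s →
    SubstBlocks (confArgs s) n 0 (varBlocks n 0) (blocks n 0 confHeads (λ i → nt (dead i)) s)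
  confArgs-subst s = varBlocks-subst n 0 (blocks n 0 confHeads (λ i → nt (dead i)) s) []

  topSym : Stack (Fin stackSymbols) n → Fin stackSymbols
  topSym = top₁ bottom n

  Out-confTerm : ∀ {m q s p f} →
    Out m (ruleFor (conf q (topSym s)) [ confArgs s ]) [] p f → Out (suc m) (confTerm q s) [] p f
  Out-confTerm {q = q} {s} d = to (Out-fill n 0 {bs = blocks n 0 confHeads (λ i → nt (dead i)) s})
    (Out-non-as (encode (conf q (topSym s))) (decode-encode (conf q (topSym s))) d)

  Out-confTerm⁻¹ : ∀ {m q s p f} → Out m (confTerm q s) [] p f →
    ∃[ m′ ] (m ≡ suc m′ × Out m′ (ruleFor (conf q (topSym s)) [ confArgs s ]) [] p f)
  Out-confTerm⁻¹ {q = q} {s} d = Out-non-as⁻¹ (encode (conf q (topSym s))) (decode-encode (conf q (topSym s)))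
    (from (Out-fill n 0 {bs = blocks n 0 confHeads (λ i → nt (dead i)) s}) d)

  heads-subst : ∀ {Γ} (τ : Args Γ) q a → confHeads q a [ τ ] ≡ confHeads q a
  heads-subst τ q a = nt-subst τ (conf q a)

  move-term : ∀ {q φ s s′} → applyOp φ s ≡ just s′ →
    confRule (topSym s) (inj₁ (q , φ)) [ confArgs s ] ≡ confTerm q s′
  move-term {q} {φ} {s} eq = opTerm-subst φ 0 (λ i → nt (dead i)) (heads-subst (confArgs s)) s
    (varBlocks n 0) (confArgs-subst s) eq q

  childTerm : Stack (Fin stackSymbols) n → Fin states → T (args (σ (0 ⊕ n))) o
  childTerm s = fill n 0 (λ r → confHeads r (topSym s)) (varBlocks n 0)

  child-term : ∀ s q → childTerm s q [ confArgs s ] ≡ confTerm q s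
  child-term s q = fill-subst n 0 (λ r → heads-subst (confArgs s) r (topSym s))
    (varBlocks n 0) (blocks n 0 confHeads (λ i → nt (dead i)) s) (confArgs-subst s) q

  groundArg-child : ∀ s {k} (qs : Vec (Fin states) k) i →
    groundArg {T []} k (groundArgs {T []} k (λ i → childTerm s (Vec.lookup qs i) [ confArgs s ])) i
      ≡ confTerm (Vec.lookup qs i) s
  groundArg-child s {k} qs i = trans (groundArg-groundArgs {T []} k _ i) (child-term s (Vec.lookup qs i))

  Out-rule : ∀ {m q s r p f} → δ q (topSym s) ≡ r →
    Out m (confRule (topSym s) r [ confArgs s ]) [] p f → Out (suc m) (confTerm q s) [] p f
  Out-rule {q = q} {s} refl d = Out-confTerm {q = q} {s} d

  Outputs⇒Out : ∀ {q s p f} → Outputs P q s p f → ∃[ m ] Out m (confTerm q s) [] p f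
  Outputs⇒Out {q} {s} {p} {f} (move {q′} {φ} eq eq′ d) with Outputs⇒Out d
  ... | m , d′ = suc m , Out-rule {q = q} {s} eq
    (subst (λ t → Out m t [] p f) (sym (move-term {q′} {φ} {s} eq′)) d′)
  Outputs⇒Out {q} {s} (root {f} {qs} eq) =
    1 , Out-rule {0} {q} {s} eq (to (Out-applyGround (arity f)) root)
  Outputs⇒Out {q} {s} (child {f} {qs} {p} {g} eq i d) with Outputs⇒Out d
  ... | m , d′ = suc m , Out-rule {m} {q} {s} eq
    (to (Out-applyGround (arity f))
      (child i (subst (λ t → Out m t [] p g) (sym (groundArg-child s qs i)) d′)))

  Out⇒Outputs : ∀ m {q s p f} → Out m (confTerm q s) [] p f → Outputs P q s p f
  Out⇒Outputs m {q} {s} d with Out-confTerm⁻¹ {m} {q} {s} d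
  Out⇒Outputs (suc m) {q} {s} {p} {f} _ | _ , refl , d with δ q (topSym s) in eq
  ... | inj₁ (q′ , φ) with applyOp φ s in eq′
  ...   | just s′ = move eq eq′ (Out⇒Outputs m (subst (λ t → Out m t [] p f) (move-term {q′} {φ} {s} eq′) d))
  ...   | nothing = ⊥-elim (opTerm-dead φ 0 {confHeads} (λ i → nt (dead i)) (λ i → dead-nt i) s
                      (varBlocks n 0) (confArgs-subst s) eq′ q′ {ts = []} d)
  Out⇒Outputs (suc m) {q} {s} _ | _ , refl , d | inj₂ (f , qs) with from (Out-applyGround (arity f)) d
  ...   | root = root eq
  ...   | child {p = p} {g} i d′ =
    child eq i (Out⇒Outputs m (subst (λ t → Out m t [] p g) (groundArg-child s qs i) d′))

  empty : Stack (Fin stackSymbols) n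
  empty = emptyStack bottom n

  Out⇔Outputs : ∀ {p f} → (∃[ m ] Out m (startTerm scheme) [] p f) ⇔ Outputs P initial empty p f
  Out⇔Outputs {p} {f} = mk⇔
    (λ { (_ , non {m = m} d) →
         Out⇒Outputs m (subst (λ t → Out m t [] p f) (subst-closed (confTerm initial empty)) d) })
    (λ d → let m , d′ = Outputs⇒Out d in
      suc m , non (subst (λ t → Out m t [] p f) (sym (subst-closed (confTerm initial empty))) d′))

  scheme-generates : ∀ {t} → Accepts P t → Generates scheme t
  scheme-generates acc p f = ⇔-trans (acc p f) (⇔-sym (⇔-trans Produces⇔Out Out⇔Outputs))

  -- Safety and order of the constructed scheme.

  SafeAt : ℕ → ∀ {Γ A} → T Γ A → Set
  SafeAt ℓ t = Safe (λ _ → ⊤) t × Vars≥ ℓ t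

  SafeBlocks : ∀ {Γ} k d → Blocks Γ k d → Set
  SafeBlocks zero    d _        = ⊤
  SafeBlocks (suc k) d (bs , Ψ) = SafeBlocks k (suc d) bs × (∀ r → SafeAt d (Ψ r))

  safeAt-weaken : ∀ {ℓ Γ A} (t : T Γ A) → SafeAt (suc ℓ) t → SafeAt ℓ t
  safeAt-weaken t (s , v) = s , AllVars-map (λ _ → <⇒≤) t v

  safeAt-· : ∀ {ℓ Γ A B} (t : T Γ (A ⇒ B)) (s : T Γ A) → ord A ≡ ℓ →
    SafeAt ℓ t → SafeAt ℓ s → SafeAt ℓ (t · s)
  safeAt-· t s refl (st , vt) (ss , vs) = (st , ss , vs) , (vt , vs)

  safe-applyBlock : ∀ {ℓ Γ} k {A B} (t : T Γ (fun k A B)) Ψ → ord A ≡ ℓ → SafeAt ℓ t →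
    (∀ r → SafeAt ℓ (Ψ r)) → SafeAt ℓ (applyBlock k {A} {B} t Ψ)
  safe-applyBlock zero    t Ψ eq st sΨ = st
  safe-applyBlock (suc k) t Ψ eq st sΨ =
    safe-applyBlock k (t · Ψ zero) (Ψ ∘ suc) eq (safeAt-· t (Ψ zero) eq st (sΨ zero)) (sΨ ∘ suc)

  safe-applyGround : ∀ {Γ} k (t : T Γ (groundTy k)) h → SafeAt 0 t → (∀ i → SafeAt 0 (h i)) →
    SafeAt 0 (applyGround k t h)
  safe-applyGround zero    t h st sh = st
  safe-applyGround (suc k) t h st sh =
    safe-applyGround k (t · h zero) (h ∘ suc) (safeAt-· t (h zero) refl st (sh zero)) (sh ∘ suc)

  -- The operands added at level `d` have order `d` and, by `SafeBlocks`, variables of order at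
  -- least `d`; the part already built has variables of order above `d`. Heads are nonterminals
  -- without variables, hence safe at every level.
  safe-fill : ∀ {Γ} k d h (bs : Blocks Γ k d) → (∀ {ℓ} q → SafeAt ℓ (h q)) → SafeBlocks k d bs →
    ∀ q → SafeAt d (fill k d h bs q)
  safe-fill zero    d h _        sh _        q = sh q
  safe-fill (suc k) d h (bs , Ψ) sh (sb , s) q =
    safe-applyBlock states (fill k (suc d) h bs q) Ψ (ord-σ d)
      (safeAt-weaken (fill k (suc d) h bs q) (safe-fill k (suc d) h bs sh sb q)) s

  safe-opTerm : ∀ {Γ k} (φ : Op (Fin stackSymbols) k) d h a (bs : Blocks Γ k d) →
    (∀ {ℓ} q a → SafeAt ℓ (h q a)) → SafeBlocks k d bs → ∀ q → SafeAt d (opTerm φ d h a bs q)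
  safe-opTerm (push₁ b) d h a (bs , Ψ) sh (sb , s) q =
    safe-applyBlock states (h q b) _ (ord-σ d) (sh q b)
      (λ r → safe-applyBlock states (h r a) Ψ (ord-σ d) (sh r a) s)
  safe-opTerm pop d h a (bs , Ψ) sh (sb , s) q = s q
  safe-opTerm (dup {k}) d h a (bs , Ψ) sh (sb , s) q =
    safe-applyBlock states (fill (suc k) (suc d) (λ r → h r a) bs q) _ (ord-σ d)
      (safeAt-weaken (fill (suc k) (suc d) (λ r → h r a) bs q)
        (safe-fill (suc k) (suc d) (λ r → h r a) bs (λ r → sh r a) sb q))
      (safe-fill (suc (suc k)) d (λ r → h r a) (bs , Ψ) (λ r → sh r a) (sb , s))
  safe-opTerm (top φ) d h a (bs , Ψ) sh (sb , s) q =
    safe-applyBlock states (opTerm φ (suc d) h a bs q) Ψ (ord-σ d)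
      (safeAt-weaken (opTerm φ (suc d) h a bs q) (safe-opTerm φ (suc d) h a bs sh sb q)) s

  safe-varBlocks : ∀ k d → SafeBlocks k d (varBlocks k d)
  safe-varBlocks zero    d = tt
  safe-varBlocks (suc k) d = safe-varBlocks k (suc d) , λ r → tt , ≤-reflexive (sym (ord-σ d))

  safe-non-as : ∀ {ℓ Γ} F {x} (eq : decode F ≡ x) → SafeAt ℓ (non-as {Γ} F eq)
  safe-non-as F refl = tt , tt

  safe-nt : ∀ {ℓ Γ} x → SafeAt ℓ (nt {Γ} x)
  safe-nt x = safe-non-as (encode x) (decode-encode x)

  safe-emptyBlocks : ∀ k d h (om : DeadTerms k d) → (∀ {ℓ} i → SafeAt ℓ (om i)) →
    SafeBlocks k d (blocks k d h om (emptyStack bottom k))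
  safe-emptyBlocks zero          d h om s = tt
  safe-emptyBlocks (suc zero)    d h om s = tt , λ _ → s zero
  safe-emptyBlocks (suc (suc k)) d h om s =
    safe-emptyBlocks (suc k) (suc d) h (om ∘ suc) (s ∘ suc) , λ _ → s zero

  safe-ruleFor : ∀ x → Safe (λ _ → ⊤) (ruleFor x)
  safe-ruleFor start = proj₁ (safe-fill n 0 _ _ (λ q → safe-nt (conf q _))
    (safe-emptyBlocks n 0 confHeads (λ i → nt (dead i)) (λ i → safe-nt (dead i))) initial)
  safe-ruleFor (dead i) = proj₁ (safe-nt {0} {args (σ (shift 0 i))} (dead zero))
  safe-ruleFor (conf q a) with δ q a
  ... | inj₁ (q′ , φ)  = proj₁ (safe-opTerm φ 0 confHeads a (varBlocks n 0)
    (λ q a → safe-nt (conf q a)) (safe-varBlocks n 0) q′)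
  ... | inj₂ (f , qs) = proj₁ (safe-applyGround (arity f) (ter f) _ (tt , tt)
    (λ i → safe-fill n 0 (λ r → confHeads r a) (varBlocks n 0) (λ r → safe-nt (conf r a))
             (safe-varBlocks n 0) (Vec.lookup qs i)))

  scheme-incrementallyBound : IncrementallyBound scheme
  scheme-incrementallyBound = safe⇒incrementallyBound (safe-ruleFor ∘ decode)

  ord-ntTy : ∀ x → ord (ntTy x) ≤ n
  ord-ntTy start      = z≤n
  ord-ntTy (dead i)   = subst (_≤ n) (sym (ord-σ (shift 0 i))) (subst (shift 0 i ≤_) (0⊕ n) (shift≤⊕ 0 i))
  ord-ntTy (conf q a) = ≤-reflexive (trans (ord-σ (0 ⊕ n)) (0⊕ n))

  scheme-order : HasOrder scheme n
  scheme-order = ord-ntTy ∘ decode , encode (conf initial bottom) ,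
    trans (cong (ord ∘ ntTy) (decode-encode (conf initial bottom))) (trans (ord-σ (0 ⊕ n)) (0⊕ n))

theorem2p3 : (Sg : RankedAlphabet) (n : ℕ) → 1 ≤ n → (t : Tree Sg) →
    (∃[ G ] (IncrementallyBound {Sg} G × HasOrder G n × Generates G t))
    ⇔ (∃[ P ] Accepts {Sg} {n} P t)
theorem2p3 Sg (suc N) _ t = mk⇔
  (λ (G , inc , (bounded , _) , gen) →
    FromScheme.pda G N , Simulation.pda-accepts G N bounded inc {t} gen)
  (λ (P , acc) →
    let open FromPDA N P
    in scheme , scheme-incrementallyBound , scheme-order , scheme-generates {t} acc)
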